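{- Let $\alpha$ be a monotone balanced non-projection connective, let $n$ be even, and let the support of $\mu$ comprise exactly the $n$ projection functions and the two constants. Then the limiting distribution of the growth process $(\mu,\alpha)$ is uniform on the slice functions in $\mathcal S_{n/2,n}$.
   Context: A connective is a $k$-adic Boolean function $\alpha:\{0,1\}^k\to\{0,1\}$; it is balanced if it takes the value 1 on exactly half of its inputs. The initial distribution $\mu$ is uniform on its support, here $\{x_1,\dots,x_n,0,1\}$. The growth process $(\mu,\alpha)$ gives distributions $\pi_i$ on $n$-adic Boolean functions: $\pi_0=\mu$, and for $i\ge1$, $\pi_i(f)$ is the probability that $\alpha(g_1,\dots,g_k)=f$ where $g_1,\dots,g_k$ are independent random functions distributed according to $\pi_{i-1}$. The limiting distribution is $\pi=\lim_{i\to\infty}\pi_i$ (pointwise). The family $\mathcal S_{m,n}$ of slice functions consists of the $n$-adic Boolean functions that take the value 1 on all assignments of weight greater than $m$, the value 0 on all assignments of weight less than $m$, and either value on assignments of weight exactly $m$ (weight = number of ones). -}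

module Defs where

open import Data.Bool.Base as Bool using (Bool; true; false; if_then_else_)
import Data.Bool.Properties as Bool
open import Data.List.Base as List
  using (List; []; _∷_; cartesianProductWith; filter; length)
import Data.List.Membership.Setoid as Membership
import Data.List.Membership.Setoid.Properties as Membershipₚ
open import Data.List.Relation.Unary.All using ([]; _∷_)
open import Data.List.Relation.Unary.AllPairs using ([]; _∷_)
open import Data.List.Relation.Unary.Any using (here; there)
import Data.List.Relation.Unary.Unique.Setoid as UniqueSetoid
import Data.List.Relation.Unary.Unique.Setoid.Properties as UniqueSetoidₚ
open import Data.Nat.Base as ℕ using (ℕ; zero; suc)
open import Data.Product using (∃; _×_; _,_)
open import Data.Rational using (ℚ; 0ℚ; 1ℚ; _+_; _-_; _*_; _≤_; _<_; ∣_∣)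
open import Data.Vec.Base as Vec using (Vec; []; _∷_; lookup; count)
open import Data.Vec.Relation.Binary.Pointwise.Inductive using (Pointwise)
open import Function using (_∘_; _⇔_; case_of_; const)
open import Relation.Binary.Bundles using (Setoid)
open import Relation.Binary.PropositionalEquality
  using (_≡_; _≗_; refl; _→-setoid_)
open import Relation.Nullary using (Dec; map′; _×-dec_)

Assignment : ℕ → Set
Assignment n = Vec Bool n

weight : ∀ {n} → Assignment n → ℕ
weight = count (Bool._≟ true)

-- Boolean functions are identified up to pointwise equality _≗_.
BoolFun : ℕ → Set
BoolFun n = Assignment n → Bool

BoolFunSetoid : ℕ → Setoid _ _
BoolFunSetoid n = Assignment n →-setoid Bool

_≗?_ : ∀ {n} (f g : BoolFun n) → Dec (f ≗ g)
_≗?_ {zero}  f g = map′ (λ { e [] → e }) (λ h → h []) (f [] Bool.≟ g [])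
_≗?_ {suc n} f g =
  map′ (λ { (p , q) (false ∷ a) → p a ; (p , q) (true ∷ a) → q a })
       (λ h → (h ∘ (false ∷_)) , (h ∘ (true ∷_)))
       (((f ∘ (false ∷_)) ≗? (g ∘ (false ∷_)))
         ×-dec ((f ∘ (true ∷_)) ≗? (g ∘ (true ∷_))))

vectors : ∀ {A : Set} → List A → ∀ k → List (Vec A k)
vectors xs zero    = [] ∷ []
vectors xs (suc k) = cartesianProductWith _∷_ xs (vectors xs k)

assignments : ∀ n → List (Assignment n)
assignments = vectors (false ∷ true ∷ [])

branch : ∀ {n} → BoolFun n → BoolFun n → BoolFun (suc n)
branch f g (b ∷ a) = if b then g a else f a

boolFuns : ∀ n → List (BoolFun n)
boolFuns zero    = const false ∷ const true ∷ []
boolFuns (suc n) = cartesianProductWith branch (boolFuns n) (boolFuns n)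

-- Each Boolean function occurs in boolFuns exactly once up to _≗_.
boolFuns-complete : ∀ {n} (f : BoolFun n) →
                    let open Membership (BoolFunSetoid n) in f ∈ boolFuns n
boolFuns-complete {zero} f with f [] in eq
... | false = here λ { [] → eq }
... | true  = there (here λ { [] → eq })
boolFuns-complete {suc n} f =
  ∈-resp-≈ (BoolFunSetoid (suc n)) split
    (∈-cartesianProductWith⁺ (BoolFunSetoid n) (BoolFunSetoid n)
      (BoolFunSetoid (suc n))
      (λ { p q (false ∷ a) → p a ; p q (true ∷ a) → q a })
      (boolFuns-complete (f ∘ (false ∷_)))
      (boolFuns-complete (f ∘ (true ∷_))))
  where
  open Membershipₚ using (∈-resp-≈; ∈-cartesianProductWith⁺)
  split : branch (f ∘ (false ∷_)) (f ∘ (true ∷_)) ≗ f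
  split (false ∷ a) = refl
  split (true  ∷ a) = refl

boolFuns-unique : ∀ n → UniqueSetoid.Unique (BoolFunSetoid n) (boolFuns n)
boolFuns-unique zero    =
  ((λ h → case h [] of λ ()) ∷ []) ∷ [] ∷ []
boolFuns-unique (suc n) =
  UniqueSetoidₚ.cartesianProductWith⁺
    (BoolFunSetoid n) (BoolFunSetoid n) (BoolFunSetoid (suc n)) branch
    (λ h → (h ∘ (false ∷_)) , (h ∘ (true ∷_)))
    (boolFuns-unique n) (boolFuns-unique n)

Connective : ℕ → Set
Connective = BoolFun

IsProjection : ∀ {n} → BoolFun n → Set
IsProjection f = ∃ λ i → f ≗ λ a → lookup a i

IsConstant : ∀ {n} → BoolFun n → Set
IsConstant f = ∃ λ b → f ≗ const b

Monotone : ∀ {n} → BoolFun n → Set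
Monotone f = ∀ {a b} → Pointwise Bool._≤_ a b → f a Bool.≤ f b

Balanced : ∀ {n} → BoolFun n → Set
Balanced {n} f =
  2 ℕ.* length (filter (λ a → f a Bool.≟ true) (assignments n)) ≡ 2 ℕ.^ n

Slice : ∀ m {n} → BoolFun n → Set
Slice m f = ∀ a → (m ℕ.< weight a → f a ≡ true) × (weight a ℕ.< m → f a ≡ false)

compose : ∀ {k n} → Connective k → Vec (BoolFun n) k → BoolFun n
compose α gs a = α (Vec.map (λ g → g a) gs)

Mass : ℕ → Set
Mass n = BoolFun n → ℚ

sum : List ℚ → ℚ
sum = List.foldr _+_ 0ℚ

product : ∀ {k} → Vec ℚ k → ℚ
product = Vec.foldr′ _*_ 1ℚ

record IsDistribution {n} (μ : Mass n) : Set where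
  field
    resp        : ∀ {f g} → f ≗ g → μ f ≡ μ g
    nonNegative : ∀ f → 0ℚ ≤ μ f
    total       : sum (List.map μ (boolFuns n)) ≡ 1ℚ

Support : ∀ {n} → Mass n → BoolFun n → Set
Support μ f = 0ℚ < μ f

record IsUniformOn {n} (P : BoolFun n → Set) (μ : Mass n) : Set where
  field
    isDistribution : IsDistribution μ
    support        : ∀ f → Support μ f ⇔ P f
    uniform        : ∀ {f g} → P f → P g → μ f ≡ μ g

-- The law of α(g₁,…,gₖ) for independent g₁,…,gₖ each with law ρ: the
-- probability of f is the total product mass of the tuples composing to f.
step : ∀ {k n} → Connective k → Mass n → Mass n
step {k} {n} α ρ f =
  sum (List.map (λ gs → product (Vec.map ρ gs))
        (filter (λ gs → compose α gs ≗? f) (vectors (boolFuns n) k)))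

growth : ∀ {k n} → Mass n → Connective k → ℕ → Mass n
growth μ α zero    = μ
growth μ α (suc i) = step α (growth μ α i)

_⟶_ : (ℕ → ℚ) → ℚ → Set
x ⟶ l = ∀ ε → 0ℚ < ε → ∃ λ N → ∀ i → N ℕ.≤ i → ∣ x i - l ∣ < ε

IsLimitingDistribution : ∀ {k n} → Mass n → Connective k → Mass n → Set
IsLimitingDistribution μ α π = ∀ f → (λ i → growth μ α i f) ⟶ π f

{-# OPTIONS --safe #-}
module Submission where

-- Encode bits by χ true = 1 and χ false = -1, and for a list S of assignments
-- let corr S be the expectation of the product of χ (F a) over a in S, where F
-- is the random function after some number of steps. The mass of each function
-- is a linear combination of correlations over lists of distinct assignments,
-- so it is enough to follow these (moment-limit).
--
-- Expanding χ ∘ α in its Fourier basis turns corr S after a step into a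
-- polynomial in correlations before it. The terms in which the assignments of
-- S all use the same set of arguments of α add up to stab ∣S∣ (χ ∘ α) (corr S),
-- and every other term contains the correlation of a proper nonempty part of S
-- (expansion). The terms of the first kind behave as follows.
--
-- * A single assignment: stab 1 is the multilinear extension F of χ ∘ α. For a
--   monotone connective with mean m it satisfies F(y) (1 + m y) ≥ m + y for
--   0 ≤ y < 1, and the reverse for -1 < y ≤ 0 (0≤margin). For a balanced one
--   that is not a projection this sharpens to y (F(y) - y) ≥ δ y² (1 - y²)
--   with δ > 0 (drift), so every nonzero bias is driven to 1 or -1.
-- * Two assignments: stab 2 is noise stability, and its modulus is at most
--   ∣c∣ (1 - δ (1 - ∣c∣)) (contract₂), since some Fourier weight lies above
--   degree one.
-- * Three or more assignments: stab r contracts by a fixed factor (contract₃),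
--   since no Fourier coefficient of χ ∘ α has modulus 1.
--
-- The constants come from splitting α on its first relevant argument, whose
-- influence m satisfies 0 < m < 1 (pivotal).
--
-- Initially corr [ a ] = (2 w - n) / (n + 2), where w is the weight of a. Hence
-- values above and below the middle layer become deterministic. In the middle
-- layer corr [ a ] stays 0, so the recursion for pairs is exact; their initial
-- correlation lies strictly between -1 and 1, because constants do not separate
-- two assignments and some projection does, and it is contracted to 0. For
-- larger lists the correlations vanish in the limit by induction on the length,
-- the terms with proper parts being a vanishing error (middle-null). In the
-- limit the middle values are therefore independent fair bits.

open import Defs
open import Data.Nat using (ℕ; _/_)
open import Data.Nat.Divisibility using (_∣_)
open import Data.Product using (∃; _×_)
open import Data.Sum using (_⊎_)
open import Relation.Nullary using (¬_)

open import Data.Bool.Base as Bool using (Bool; true; false; _∧_; if_then_else_; f≤t; b≤b)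
import Data.Bool.Properties as Bool
open import Data.Fin.Base using (Fin; zero; suc)
import Data.Fin.Properties as Fin
open import Data.Integer.Base as ℤ using (-[1+_])
import Data.Integer.Properties as ℤ
open import Data.List.Base as List
  using (List; []; _∷_; _++_; map; length; filter; cartesianProductWith)
open import Data.List.Membership.Propositional using (_∈_)
open import Data.List.Membership.Propositional.Properties
  using (∈-tabulate⁺; ∈-cartesianProductWith⁺)
open import Data.List.Properties using (++-identityʳ; length-++; map-tabulate)
open import Data.List.Relation.Binary.Permutation.Propositional
  using (_↭_; ↭-refl; ↭-trans; ↭-sym; ↭-reflexive; ↭⇒↭ₛ)
open import Data.List.Relation.Binary.Permutation.Propositional.Properties
  using (shift; ++⁺ˡ; All-resp-↭; ↭-length)
import Data.List.Relation.Binary.Permutation.Setoid.Properties as Permutation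
open import Data.List.Relation.Unary.All as All using (All; []; _∷_)
import Data.List.Relation.Unary.All.Properties as All
open import Data.List.Relation.Unary.AllPairs using ([]; _∷_)
open import Data.List.Relation.Unary.Any as Any using (Any; here; there)
import Data.List.Relation.Unary.Any.Properties as Any
open import Data.List.Relation.Unary.Unique.Propositional using (Unique)
import Data.List.Relation.Unary.Unique.Propositional.Properties as Unique
import Data.List.Relation.Unary.Unique.Setoid as UniqueSetoid
import Data.List.Relation.Unary.Unique.Setoid.Properties as UniqueSetoid
open import Data.Nat.Base as ℕ using (zero; suc)
open import Data.Nat.Coprimality using (1-coprimeTo)
import Data.Nat.Coprimality as Coprime
open import Data.Nat.DivMod using (m/n*n≡m)
import Data.Nat.Properties as ℕ
open import Data.Product using (_,_; proj₁; proj₂)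
open import Data.Rational
  using (ℚ; mkℚ; 0ℚ; 1ℚ; ½; _+_; _-_; _*_; -_; 1/_; _≤_; _<_; *≤*; ∣_∣;
         positive; nonNegative; >-nonZero)
open import Data.Rational.Properties hiding (_≟_)
import Data.Rational.Properties as ℚ
open import Data.Rational.Solver using (module +-*-Solver)
open import Data.Sum using (inj₁; inj₂)
open import Data.Vec.Base as Vec using (Vec; []; _∷_; lookup; replicate; _[_]≔_)
open import Data.Vec.Properties
  using (lookup-replicate; lookup∘update; lookup∘update′; count≤n; ∷-injective)
open import Data.Vec.Relation.Binary.Pointwise.Inductive as Pointwise using ([]; _∷_)
open import Function using (_∘_; const; Equivalence; mk⇔)
open import Relation.Binary.Definitions using (Tri; tri<; tri≈; tri>)
open import Relation.Binary.PropositionalEquality hiding (resp)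
open import Relation.Nullary using (Dec; yes; no; does; contradiction)
open import Relation.Nullary.Decidable using (dec-true; dec-false)

open +-*-Solver using (solve; _:=_; _:+_; _:*_; _:-_; :-_; con)

-- Rational arithmetic

0≤1 : 0ℚ ≤ 1ℚ
0≤1 = nonNegative⁻¹ 1ℚ

0<1 : 0ℚ < 1ℚ
0<1 = positive⁻¹ 1ℚ

0≤½ : 0ℚ ≤ ½
0≤½ = nonNegative⁻¹ ½

0<½ : 0ℚ < ½
0<½ = positive⁻¹ ½

0≤+ : ∀ {p q} → 0ℚ ≤ p → 0ℚ ≤ q → 0ℚ ≤ p + q
0≤+ = +-mono-≤

0≤* : ∀ {p q} → 0ℚ ≤ p → 0ℚ ≤ q → 0ℚ ≤ p * q
0≤* {p} {q} 0≤p 0≤q =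
  nonNegative⁻¹ (p * q) {{nonNeg*nonNeg⇒nonNeg p {{nonNegative 0≤p}} q {{nonNegative 0≤q}}}}

0<* : ∀ {p q} → 0ℚ < p → 0ℚ < q → 0ℚ < p * q
0<* {p} {q} 0<p 0<q =
  positive⁻¹ (p * q) {{pos*pos⇒pos p {{positive 0<p}} q {{positive 0<q}}}}

-- An inequality follows from an identity exhibiting the difference of its
-- sides as a nonnegative (or positive) quantity.
≤-from : ∀ {p q r} → 0ℚ ≤ r → q ≡ p + r → p ≤ q
≤-from {p} {q} {r} 0≤r refl = subst (_≤ p + r) (+-identityʳ p) (+-monoʳ-≤ p 0≤r)

<-from : ∀ {p q r} → 0ℚ < r → q ≡ p + r → p < q
<-from {p} {q} {r} 0<r refl = subst (_< p + r) (+-identityʳ p) (+-monoʳ-< p 0<r)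

0≤- : ∀ {p q} → p ≤ q → 0ℚ ≤ q - p
0≤- {p} {q} p≤q = subst (_≤ q - p) (+-inverseʳ p) (+-monoˡ-≤ (- p) p≤q)

0<- : ∀ {p q} → p < q → 0ℚ < q - p
0<- {p} {q} p<q = subst (_< q - p) (+-inverseʳ p) (+-monoˡ-< (- p) p<q)

p-0≡p : ∀ p → p - 0ℚ ≡ p
p-0≡p = solve 1 (λ p → p :- con 0ℚ := p) refl

0≤p² : ∀ p → 0ℚ ≤ p * p
0≤p² p with ≤-total 0ℚ p
... | inj₁ 0≤p = 0≤* 0≤p 0≤p
... | inj₂ p≤0 = ≤-from (0≤* (0≤- p≤0) (0≤- p≤0))
  (solve 1 (λ p → p :* p := con 0ℚ :+ (con 0ℚ :- p) :* (con 0ℚ :- p)) refl p)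

p≤∣p∣ : ∀ p → p ≤ ∣ p ∣
p≤∣p∣ p with ≤-total 0ℚ p
... | inj₁ 0≤p = ≤-reflexive (sym (0≤p⇒∣p∣≡p 0≤p))
... | inj₂ p≤0 = ≤-trans p≤0 (0≤∣p∣ p)

-p≤∣p∣ : ∀ p → - p ≤ ∣ p ∣
-p≤∣p∣ p = subst (- p ≤_) (∣-p∣≡∣p∣ p) (p≤∣p∣ (- p))

∣∣≤ : ∀ {p q} → p ≤ q → - p ≤ q → ∣ p ∣ ≤ q
∣∣≤ {p} p≤q -p≤q with ∣p∣≡p∨∣p∣≡-p p
... | inj₁ e = subst (_≤ _) (sym e) p≤q
... | inj₂ e = subst (_≤ _) (sym e) -p≤q

∣∣< : ∀ {p q} → p < q → - p < q → ∣ p ∣ < q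
∣∣< {p} p<q -p<q with ∣p∣≡p∨∣p∣≡-p p
... | inj₁ e = subst (_< _) (sym e) p<q
... | inj₂ e = subst (_< _) (sym e) -p<q

0≤1-∣∣ : ∀ {p} → ∣ p ∣ ≤ 1ℚ → 0ℚ ≤ 1ℚ - p
0≤1-∣∣ {p} ∣p∣≤1 = 0≤- (≤-trans (p≤∣p∣ p) ∣p∣≤1)

0≤1+∣∣ : ∀ {p} → ∣ p ∣ ≤ 1ℚ → 0ℚ ≤ 1ℚ + p
0≤1+∣∣ {p} ∣p∣≤1 = ≤-from (0≤- (≤-trans (-p≤∣p∣ p) ∣p∣≤1))
  (solve 1 (λ p → con 1ℚ :+ p := con 0ℚ :+ (con 1ℚ :- (:- p))) refl p)

∣*∣≤∣∣ : ∀ p {q} → ∣ q ∣ ≤ 1ℚ → ∣ p * q ∣ ≤ ∣ p ∣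
∣*∣≤∣∣ p {q} ∣q∣≤1 = ≤-from (0≤* (0≤∣p∣ p) (0≤- ∣q∣≤1))
  (trans (solve 2 (λ p q → p := p :* q :+ p :* (con 1ℚ :- q)) refl ∣ p ∣ ∣ q ∣)
         (cong (_+ ∣ p ∣ * (1ℚ - ∣ q ∣)) (sym (∣p*q∣≡∣p∣*∣q∣ p q))))

∣*∣≤1 : ∀ {p q} → ∣ p ∣ ≤ 1ℚ → ∣ q ∣ ≤ 1ℚ → ∣ p * q ∣ ≤ 1ℚ
∣*∣≤1 {p} p≤ q≤ = ≤-trans (∣*∣≤∣∣ p q≤) p≤

infixr 8 _^_

_^_ : ℚ → ℕ → ℚ
p ^ zero  = 1ℚ
p ^ suc n = p * p ^ n

0≤^ : ∀ {p} n → 0ℚ ≤ p → 0ℚ ≤ p ^ n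
0≤^ zero    0≤p = 0≤1
0≤^ (suc n) 0≤p = 0≤* 0≤p (0≤^ n 0≤p)

0<^ : ∀ {p} n → 0ℚ < p → 0ℚ < p ^ n
0<^ zero    0<p = 0<1
0<^ (suc n) 0<p = 0<* 0<p (0<^ n 0<p)

^≤1 : ∀ {p} n → 0ℚ ≤ p → p ≤ 1ℚ → p ^ n ≤ 1ℚ
^≤1 zero    0≤p p≤1 = ≤-refl
^≤1 {p} (suc n) 0≤p p≤1 = ≤-from
  (0≤+ (0≤- p≤1) (0≤* 0≤p (0≤- (^≤1 n 0≤p p≤1))))
  (solve 2 (λ p q → con 1ℚ := p :* q :+ ((con 1ℚ :- p) :+ p :* (con 1ℚ :- q))) refl p (p ^ n))

∣^∣ : ∀ p n → ∣ p ^ n ∣ ≡ ∣ p ∣ ^ n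
∣^∣ p zero    = refl
∣^∣ p (suc n) = trans (∣p*q∣≡∣p∣*∣q∣ p (p ^ n)) (cong (∣ p ∣ *_) (∣^∣ p n))

-- The embedding of the natural numbers.
⟦_⟧ : ℕ → ℚ
⟦ zero  ⟧ = 0ℚ
⟦ suc n ⟧ = 1ℚ + ⟦ n ⟧

0≤⟦_⟧ : ∀ n → 0ℚ ≤ ⟦ n ⟧
0≤⟦ zero  ⟧ = ≤-refl
0≤⟦ suc n ⟧ = 0≤+ 0≤1 0≤⟦ n ⟧

⟦⟧-homo-+ : ∀ m n → ⟦ m ℕ.+ n ⟧ ≡ ⟦ m ⟧ + ⟦ n ⟧
⟦⟧-homo-+ zero    n = sym (+-identityˡ ⟦ n ⟧)
⟦⟧-homo-+ (suc m) n = trans (cong (1ℚ +_) (⟦⟧-homo-+ m n)) (sym (+-assoc 1ℚ ⟦ m ⟧ ⟦ n ⟧))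

⟦⟧-mono : ∀ {m n} → m ℕ.≤ n → ⟦ m ⟧ ≤ ⟦ n ⟧
⟦⟧-mono {n = n} ℕ.z≤n = 0≤⟦ n ⟧
⟦⟧-mono (ℕ.s≤s m≤n)   = +-monoʳ-≤ 1ℚ (⟦⟧-mono m≤n)

⟦⟧≡mkℚ : ∀ n → ⟦ n ⟧ ≡ mkℚ (ℤ.+ n) 0 (Coprime.sym (1-coprimeTo n))
⟦⟧≡mkℚ zero    = refl
⟦⟧≡mkℚ (suc n) = trans (cong (1ℚ +_) (⟦⟧≡mkℚ n))
  (trans (cong (Data.Rational._/ 1) (cong (ℤ._+_ (ℤ.+ 1)) (ℤ.*-identityʳ (ℤ.+ n))))
         (normalize-coprime (Coprime.sym (1-coprimeTo (suc n)))))

≤⟦⟧ : ∀ p → ∃ λ n → p ≤ ⟦ n ⟧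
≤⟦⟧ (mkℚ p d c) = ℤ.∣ p ∣ , subst (mkℚ p d c ≤_) (sym (⟦⟧≡mkℚ ℤ.∣ p ∣)) (*≤* (lemma p))
  where
  lemma : ∀ p → p ℤ.* ℤ.+ 1 ℤ.≤ ℤ.+ ℤ.∣ p ∣ ℤ.* ℤ.+ suc d
  lemma (ℤ.+ p)    = ℤ.*-monoˡ-≤-nonNeg (ℤ.+ p) (ℤ.+≤+ (ℕ.s≤s ℕ.z≤n))
  lemma -[1+ p ] = ℤ.-≤+

archimedean : ∀ p {q} → 0ℚ < q → ∃ λ n → p ≤ ⟦ n ⟧ * q
archimedean p {q} 0<q = n , subst (_≤ ⟦ n ⟧ * q) p/q*q
    (*-monoʳ-≤-nonNeg q {{pos⇒nonNeg q {{positive 0<q}}}} p/q≤n)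
  where
  instance _ = >-nonZero 0<q
  n = proj₁ (≤⟦⟧ (p * 1/ q))
  p/q≤n = proj₂ (≤⟦⟧ (p * 1/ q))
  p/q*q : p * 1/ q * q ≡ p
  p/q*q = trans (*-assoc p (1/ q) q) (trans (cong (p *_) (*-inverseˡ q)) (*-identityʳ p))

-- Limits

-- The relation x ⟶ l, wrapped so that the sequence and its limit can be
-- recovered from the type.
record Converges (x : ℕ → ℚ) (l : ℚ) : Set where
  constructor converges
  field within : x ⟶ l

open Converges public

⟶-cong : ∀ {x y l} → (∀ i → x i ≡ y i) → Converges x l → Converges y l
⟶-cong {l = l} x≡y xl .within ε 0<ε =
  let N , h = xl .within ε 0<ε in
  N , λ i N≤i → subst (λ z → ∣ z - l ∣ < ε) (x≡y i) (h i N≤i)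

⟶-const : ∀ l → Converges (λ _ → l) l
⟶-const l .within ε 0<ε = 0 , λ _ _ → subst (_< ε) (cong ∣_∣ (sym (+-inverseʳ l))) 0<ε

⟶-+ : ∀ {x y l m} → Converges x l → Converges y m → Converges (λ i → x i + y i) (l + m)
⟶-+ {x} {y} {l} {m} xl ym .within ε 0<ε =
  let M , f = xl .within (½ * ε) (0<* 0<½ 0<ε)
      N , g = ym .within (½ * ε) (0<* 0<½ 0<ε)
  in M ℕ.⊔ N , λ i M⊔N≤i →
    subst (λ z → ∣ z ∣ < ε)
      (solve 4 (λ x y l m → (x :- l) :+ (y :- m) := (x :+ y) :- (l :+ m)) refl (x i) (y i) l m)
      (≤-<-trans (∣p+q∣≤∣p∣+∣q∣ (x i - l) (y i - m))
        (subst (∣ x i - l ∣ + ∣ y i - m ∣ <_) (solve 1 (λ e → con ½ :* e :+ con ½ :* e := e) refl ε)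
          (+-mono-< (f i (ℕ.≤-trans (ℕ.m≤m⊔n M N) M⊔N≤i)) (g i (ℕ.≤-trans (ℕ.m≤n⊔m M N) M⊔N≤i)))))

-- Scalars of absolute value at most 1 are enough below, and need no division.
⟶-*ˡ : ∀ {c x l} → ∣ c ∣ ≤ 1ℚ → Converges x l → Converges (λ i → c * x i) (c * l)
⟶-*ˡ {c} {x} {l} ∣c∣≤1 xl .within ε 0<ε =
  let N , f = xl .within ε 0<ε in N , λ i N≤i →
    subst (λ z → ∣ z ∣ < ε)
      (solve 3 (λ c x l → (x :- l) :* c := c :* x :- c :* l) refl c (x i) l)
      (≤-<-trans (∣*∣≤∣∣ (x i - l) ∣c∣≤1) (f i N≤i))

⟶0-dominated : ∀ {x y} → (∀ i → ∣ x i ∣ ≤ ∣ y i ∣) → Converges y 0ℚ → Converges x 0ℚ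
⟶0-dominated {x} {y} x≤y y0 .within ε 0<ε =
  let N , f = y0 .within ε 0<ε in N , λ i N≤i →
    ≤-<-trans (subst₂ _≤_ (cong ∣_∣ (sym (p-0≡p (x i)))) (cong ∣_∣ (sym (p-0≡p (y i)))) (x≤y i)) (f i N≤i)

⟶0-∣∣ : ∀ {x} → Converges x 0ℚ → Converges (λ i → ∣ x i ∣) 0ℚ
⟶0-∣∣ {x} = ⟶0-dominated (λ i → ≤-reflexive (∣∣p∣∣≡∣p∣ (x i)))

⟶0-∣∣⁻ : ∀ {x} → Converges (λ i → ∣ x i ∣) 0ℚ → Converges x 0ℚ
⟶0-∣∣⁻ {x} = ⟶0-dominated (λ i → ≤-reflexive (sym (∣∣p∣∣≡∣p∣ (x i))))

⟶-near : ∀ {x y l} → Converges (λ i → x i - y i) 0ℚ → Converges y l → Converges x l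
⟶-near {x} {y} {l} xy yl =
  ⟶-cong (λ i → solve 2 (λ x y → (x :- y) :+ y := x) refl (x i) (y i))
    (subst (Converges (λ i → (x i - y i) + y i)) (+-identityˡ l) (⟶-+ xy yl))

⟶-const-unique : ∀ {l m} → Converges (λ _ → l) m → l ≡ m
⟶-const-unique {l} {m} lm with l ℚ.≟ m
... | yes l≡m = l≡m
... | no  l≢m =
  let N , f = lm .within ∣ l - m ∣ 0<∣∣ in contradiction (f N ℕ.≤-refl) (<-irrefl refl)
  where
  0<∣∣ : 0ℚ < ∣ l - m ∣
  0<∣∣ with <-cmp 0ℚ ∣ l - m ∣
  ... | tri< 0< _ _ = 0<
  ... | tri≈ _ 0≡ _ = contradiction
    (trans (solve 2 (λ l m → l := (l :- m) :+ m) refl l m)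
      (trans (cong (_+ m) (∣p∣≡0⇒p≡0 (l - m) (sym 0≡))) (+-identityˡ m))) l≢m
  ... | tri> _ _ <0 = contradiction (<-≤-trans <0 (0≤∣p∣ (l - m))) (<-irrefl refl)

-- Bernoulli's inequality in the form (1 - δ)ⁿ (1 + n δ) ≤ 1.
bernoulli : ∀ {δ} → 0ℚ ≤ δ → δ ≤ 1ℚ → ∀ n → (1ℚ - δ) ^ n * (1ℚ + ⟦ n ⟧ * δ) ≤ 1ℚ
bernoulli {δ} 0≤δ δ≤1 zero =
  ≤-reflexive (solve 1 (λ d → con 1ℚ :* (con 1ℚ :+ con 0ℚ :* d) := con 1ℚ) refl δ)
bernoulli {δ} 0≤δ δ≤1 (suc n) = ≤-trans
  (≤-from (0≤* (0≤^ n (0≤- δ≤1)) (0≤* (0≤p² δ) 0≤⟦ suc n ⟧))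
    (solve 3 (λ d p n → p :* (con 1ℚ :+ n :* d) :=
        ((con 1ℚ :- d) :* p) :* (con 1ℚ :+ (con 1ℚ :+ n) :* d) :+ p :* (d :* d :* (con 1ℚ :+ n)))
      refl δ ((1ℚ - δ) ^ n) ⟦ n ⟧))
  (bernoulli 0≤δ δ≤1 n)

-- A sequence that contracts by a fixed factor up to a vanishing error vanishes.
contracting : ∀ {z e : ℕ → ℚ} {δ} → 0ℚ < δ → δ ≤ 1ℚ → (∀ i → 0ℚ ≤ z i) → Converges e 0ℚ →
              (∀ i → z (suc i) ≤ (1ℚ - δ) * z i + e i) → Converges z 0ℚ
contracting {z} {e} {δ} 0<δ δ≤1 0≤z e0 z≤ .within ε 0<ε = N ℕ.+ M , final
  where
  -- From N on the error is at most δ η, which keeps z below its geometrically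
  -- decaying part plus η; from N + M on that part is at most η as well.
  η = ½ * (½ * ε)
  0<η : 0ℚ < η
  0<η = 0<* 0<½ (0<* 0<½ 0<ε)
  N = proj₁ (e0 .within (δ * η) (0<* 0<δ 0<η))
  e≤ : ∀ j → e (j ℕ.+ N) ≤ δ * η
  e≤ j = ≤-trans (p≤∣p∣ _) (<⇒≤ (subst (_< δ * η) (cong ∣_∣ (p-0≡p _))
    (proj₂ (e0 .within (δ * η) (0<* 0<δ 0<η)) (j ℕ.+ N) (ℕ.m≤n+m N j))))
  M = proj₁ (archimedean (z N) (0<* 0<δ 0<η))
  step≤ : ∀ j → z (j ℕ.+ N) ≤ (1ℚ - δ) ^ j * z N + η
  step≤ zero = ≤-from (<⇒≤ 0<η) (cong (_+ η) (*-identityˡ (z N)))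
  step≤ (suc j) = ≤-trans (z≤ (j ℕ.+ N)) (≤-trans
    (+-mono-≤ (*-monoˡ-≤-nonNeg (1ℚ - δ) {{nonNegative (0≤- δ≤1)}} (step≤ j)) (e≤ j))
    (≤-reflexive (solve 4 (λ d p z h → (con 1ℚ :- d) :* (p :* z :+ h) :+ d :* h := (con 1ℚ :- d) :* p :* z :+ h)
      refl δ ((1ℚ - δ) ^ j) (z N) η)))
  decay : ∀ j → M ℕ.≤ j → (1ℚ - δ) ^ j * z N ≤ η
  decay j M≤j = ≤-trans
    (*-monoˡ-≤-nonNeg ((1ℚ - δ) ^ j) {{nonNegative 0≤q}}
      (≤-trans (proj₂ (archimedean (z N) (0<* 0<δ 0<η)))
        (*-monoʳ-≤-nonNeg (δ * η) {{nonNegative (0≤* (<⇒≤ 0<δ) (<⇒≤ 0<η))}} (⟦⟧-mono M≤j))))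
    (≤-from (0≤+ (0≤* (<⇒≤ 0<η) (0≤- (bernoulli (<⇒≤ 0<δ) δ≤1 j))) (0≤* (<⇒≤ 0<η) 0≤q))
      (solve 4 (λ d h q n → h := q :* (n :* (d :* h)) :+ (h :* (con 1ℚ :- q :* (con 1ℚ :+ n :* d)) :+ h :* q))
        refl δ η ((1ℚ - δ) ^ j) ⟦ j ⟧))
    where
    0≤q = 0≤^ j (0≤- δ≤1)
  final : ∀ i → N ℕ.+ M ℕ.≤ i → ∣ z i - 0ℚ ∣ < ε
  final i N+M≤i = subst (_< ε) (sym (trans (cong ∣_∣ (p-0≡p (z i))) (0≤p⇒∣p∣≡p (0≤z i))))
    (subst (λ k → z k < ε) (ℕ.m∸n+n≡m (ℕ.≤-trans (ℕ.m≤m+n N M) N+M≤i))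
      (≤-<-trans (≤-trans (step≤ j) (+-monoˡ-≤ η (decay j M≤j)))
        (<-from (0<* 0<½ 0<ε)
          (solve 1 (λ e → e := (con ½ :* (con ½ :* e) :+ con ½ :* (con ½ :* e)) :+ con ½ :* e) refl ε))))
    where
    j = i ℕ.∸ N
    M≤j : M ℕ.≤ j
    M≤j = subst (ℕ._≤ j) (ℕ.m+n∸m≡n N M) (ℕ.∸-monoˡ-≤ N N+M≤i)

-- Finite sums

-- The sum of f over the entries of a list, counted with multiplicity.
∑ : ∀ {A : Set} → List A → (A → ℚ) → ℚ
∑ xs f = sum (map f xs)

module _ {A : Set} where

  ∑-cong : ∀ (xs : List A) {f g} → (∀ x → f x ≡ g x) → ∑ xs f ≡ ∑ xs g
  ∑-cong []       f≡g = refl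
  ∑-cong (x ∷ xs) f≡g = cong₂ _+_ (f≡g x) (∑-cong xs f≡g)

  ∑-0 : ∀ (xs : List A) → ∑ xs (const 0ℚ) ≡ 0ℚ
  ∑-0 []       = refl
  ∑-0 (x ∷ xs) = trans (+-identityˡ (∑ xs (const 0ℚ))) (∑-0 xs)

  ∑-+ : ∀ (xs : List A) f g → ∑ xs (λ x → f x + g x) ≡ ∑ xs f + ∑ xs g
  ∑-+ []       f g = refl
  ∑-+ (x ∷ xs) f g = trans (cong (f x + g x +_) (∑-+ xs f g))
    (solve 4 (λ a b c d → a :+ b :+ (c :+ d) := a :+ c :+ (b :+ d)) refl (f x) (g x) (∑ xs f) (∑ xs g))

  ∑-*ˡ : ∀ (xs : List A) c f → ∑ xs (λ x → c * f x) ≡ c * ∑ xs f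
  ∑-*ˡ []       c f = sym (*-zeroʳ c)
  ∑-*ˡ (x ∷ xs) c f = trans (cong (c * f x +_) (∑-*ˡ xs c f)) (sym (*-distribˡ-+ c (f x) (∑ xs f)))

  ∑-++ : ∀ (xs ys : List A) f → ∑ (xs ++ ys) f ≡ ∑ xs f + ∑ ys f
  ∑-++ []       ys f = sym (+-identityˡ (∑ ys f))
  ∑-++ (x ∷ xs) ys f = trans (cong (f x +_) (∑-++ xs ys f)) (sym (+-assoc (f x) (∑ xs f) (∑ ys f)))

  ∑-0≤ : ∀ (xs : List A) {f} → (∀ x → 0ℚ ≤ f x) → 0ℚ ≤ ∑ xs f
  ∑-0≤ []       0≤f = ≤-refl
  ∑-0≤ (x ∷ xs) 0≤f = 0≤+ (0≤f x) (∑-0≤ xs 0≤f)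

  ∑-mono : ∀ (xs : List A) {f g} → (∀ x → f x ≤ g x) → ∑ xs f ≤ ∑ xs g
  ∑-mono []       f≤g = ≤-refl
  ∑-mono (x ∷ xs) f≤g = +-mono-≤ (f≤g x) (∑-mono xs f≤g)

  term≤∑ : ∀ {xs : List A} {f x} → (∀ x → 0ℚ ≤ f x) → x ∈ xs → f x ≤ ∑ xs f
  term≤∑ {x ∷ xs} {f} 0≤f (here refl) = ≤-from (∑-0≤ xs 0≤f) refl
  term≤∑ {y ∷ xs} {f} 0≤f (there x∈)  =
    ≤-trans (term≤∑ 0≤f x∈) (≤-from (0≤f y) (+-comm (f y) (∑ xs f)))

∑-swap : ∀ {A B : Set} (xs : List A) (ys : List B) (f : A → B → ℚ) →
         ∑ xs (λ x → ∑ ys (f x)) ≡ ∑ ys (λ y → ∑ xs (λ x → f x y))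
∑-swap []       ys f = sym (∑-0 ys)
∑-swap (x ∷ xs) ys f = trans (cong (∑ ys (f x) +_) (∑-swap xs ys f))
  (sym (∑-+ ys (f x) (λ y → ∑ xs (λ x → f x y))))

∑-map : ∀ {A B : Set} (h : A → B) xs f → ∑ (map h xs) f ≡ ∑ xs (f ∘ h)
∑-map h []       f = refl
∑-map h (x ∷ xs) f = cong (f (h x) +_) (∑-map h xs f)

∑-cartesianProductWith : ∀ {A B C : Set} (h : A → B → C) xs ys f →
  ∑ (cartesianProductWith h xs ys) f ≡ ∑ xs (λ x → ∑ ys (λ y → f (h x y)))
∑-cartesianProductWith h []       ys f = refl
∑-cartesianProductWith h (x ∷ xs) ys f = trans (∑-++ (map (h x) ys) (cartesianProductWith h xs ys) f)
  (cong₂ _+_ (∑-map (h x) ys f) (∑-cartesianProductWith h xs ys f))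

⟶-∑ : ∀ {A : Set} (L : List A) {x : A → ℕ → ℚ} {l : A → ℚ} → (∀ a → Converges (x a) (l a)) →
      Converges (λ i → ∑ L (λ a → x a i)) (∑ L l)
⟶-∑ []      xl = ⟶-const 0ℚ
⟶-∑ (a ∷ L) xl = ⟶-+ (xl a) (⟶-∑ L xl)

-- The value 1 or 0 according to whether P holds.
indicator : ∀ {P : Set} → Dec P → ℚ
indicator P? = if does P? then 1ℚ else 0ℚ

∑-filter : ∀ {A : Set} {P : A → Set} (P? : ∀ x → Dec (P x)) xs f →
           ∑ (filter P? xs) f ≡ ∑ xs (λ x → indicator (P? x) * f x)
∑-filter P? []       f = refl
∑-filter P? (x ∷ xs) f with does (P? x)
... | true  = cong₂ _+_ (sym (*-identityˡ (f x))) (∑-filter P? xs f)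
... | false = trans (∑-filter P? xs f)
  (sym (trans (cong (_+ rest) (*-zeroˡ (f x))) (+-identityˡ rest)))
  where rest = ∑ xs (λ x → indicator (P? x) * f x)

-- Expectations

-- Well defined on Boolean functions, that is, up to pointwise equality.
Respects : ∀ {n} → (BoolFun n → ℚ) → Set
Respects φ = ∀ {f g} → f ≗ g → φ f ≡ φ g

-- The expectation of φ under the mass function ρ.
𝔼 : ∀ {n} → Mass n → (BoolFun n → ℚ) → ℚ
𝔼 {n} ρ φ = ∑ (boolFuns n) (λ f → ρ f * φ f)

-- Every Boolean function is listed exactly once, so a sum against the
-- indicator of h picks out the value at h.
∑-indicator : ∀ {n} (h : BoolFun n) {φ} → Respects φ →
              ∑ (boolFuns n) (λ f → indicator (h ≗? f) * φ f) ≡ φ h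
∑-indicator {zero} h {φ} φ-resp with h [] in eq
... | false = trans (solve 2 (λ p q → con 1ℚ :* p :+ (con 0ℚ :* q :+ con 0ℚ) := p) refl
                      (φ (const false)) (φ (const true)))
                    (φ-resp λ { [] → sym eq })
... | true  = trans (solve 2 (λ p q → con 0ℚ :* p :+ (con 1ℚ :* q :+ con 0ℚ) := q) refl
                      (φ (const false)) (φ (const true)))
                    (φ-resp λ { [] → sym eq })
∑-indicator {suc n} h {φ} φ-resp = begin
  ∑ (boolFuns (suc n)) (λ f → indicator (h ≗? f) * φ f)
    ≡⟨ ∑-cartesianProductWith branch (boolFuns n) (boolFuns n) _ ⟩
  ∑ (boolFuns n) (λ f → ∑ (boolFuns n) (λ g → indicator (h ≗? branch f g) * φ (branch f g)))
    ≡⟨ ∑-cong (boolFuns n) (λ f → ∑-cong (boolFuns n) (λ g → split f g)) ⟩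
  ∑ (boolFuns n) (λ f → ∑ (boolFuns n) (λ g →
    indicator (h₀ ≗? f) * (indicator (h₁ ≗? g) * φ (branch f g))))
    ≡⟨ ∑-cong (boolFuns n) (λ f → trans
         (∑-*ˡ (boolFuns n) (indicator (h₀ ≗? f)) (λ g → indicator (h₁ ≗? g) * φ (branch f g)))
         (cong (indicator (h₀ ≗? f) *_) (∑-indicator h₁ {λ g → φ (branch f g)}
            (λ e → φ-resp λ { (false ∷ a) → refl ; (true ∷ a) → e a })))) ⟩
  ∑ (boolFuns n) (λ f → indicator (h₀ ≗? f) * φ (branch f h₁))
    ≡⟨ ∑-indicator h₀ {λ f → φ (branch f h₁)}
         (λ e → φ-resp λ { (false ∷ a) → e a ; (true ∷ a) → refl }) ⟩
  φ (branch h₀ h₁)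
    ≡⟨ φ-resp (λ { (false ∷ a) → refl ; (true ∷ a) → refl }) ⟩
  φ h ∎
  where
  open ≡-Reasoning
  h₀ = h ∘ (false ∷_)
  h₁ = h ∘ (true ∷_)
  split : ∀ f g → indicator (h ≗? branch f g) * φ (branch f g) ≡
                  indicator (h₀ ≗? f) * (indicator (h₁ ≗? g) * φ (branch f g))
  split f g = factor (does (h₀ ≗? f)) (does (h₁ ≗? g))
    where
    factor : ∀ b c → (if b ∧ c then 1ℚ else 0ℚ) * φ (branch f g) ≡
                     (if b then 1ℚ else 0ℚ) * ((if c then 1ℚ else 0ℚ) * φ (branch f g))
    factor true  c = sym (*-identityˡ ((if c then 1ℚ else 0ℚ) * φ (branch f g)))
    factor false c = trans (*-zeroˡ (φ (branch f g)))
                           (sym (*-zeroˡ ((if c then 1ℚ else 0ℚ) * φ (branch f g))))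

module _ {n} (ρ : Mass n) where

  𝔼-cong : ∀ {φ ψ} → (∀ f → φ f ≡ ψ f) → 𝔼 ρ φ ≡ 𝔼 ρ ψ
  𝔼-cong φ≡ψ = ∑-cong (boolFuns n) (λ f → cong (ρ f *_) (φ≡ψ f))

  𝔼-+ : ∀ φ ψ → 𝔼 ρ (λ f → φ f + ψ f) ≡ 𝔼 ρ φ + 𝔼 ρ ψ
  𝔼-+ φ ψ = trans (∑-cong (boolFuns n) (λ f → *-distribˡ-+ (ρ f) (φ f) (ψ f)))
                  (∑-+ (boolFuns n) (λ f → ρ f * φ f) (λ f → ρ f * ψ f))

  𝔼-*ˡ : ∀ c φ → 𝔼 ρ (λ f → c * φ f) ≡ c * 𝔼 ρ φ
  𝔼-*ˡ c φ = trans
    (∑-cong (boolFuns n) (λ f → solve 3 (λ r c p → r :* (c :* p) := c :* (r :* p)) refl (ρ f) c (φ f)))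
    (∑-*ˡ (boolFuns n) c (λ f → ρ f * φ f))

-- Expectation over k independent functions, computed one function at a time.
𝔼ᵏ : ∀ {n} → Mass n → ∀ k → (Vec (BoolFun n) k → ℚ) → ℚ
𝔼ᵏ ρ zero    Φ = Φ []
𝔼ᵏ ρ (suc k) Φ = 𝔼 ρ (λ g → 𝔼ᵏ ρ k (λ gs → Φ (g ∷ gs)))

module _ {n} (ρ : Mass n) where

  ∑-vectors : ∀ k Φ →
    ∑ (vectors (boolFuns n) k) (λ gs → product (Vec.map ρ gs) * Φ gs) ≡ 𝔼ᵏ ρ k Φ
  ∑-vectors zero    Φ = solve 1 (λ p → con 1ℚ :* p :+ con 0ℚ := p) refl (Φ [])
  ∑-vectors (suc k) Φ = trans
    (∑-cartesianProductWith _∷_ (boolFuns n) (vectors (boolFuns n) k) _)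
    (∑-cong (boolFuns n) (λ g → trans
      (∑-cong (vectors (boolFuns n) k) (λ gs → *-assoc (ρ g) (product (Vec.map ρ gs)) (Φ (g ∷ gs))))
      (trans (∑-*ˡ (vectors (boolFuns n) k) (ρ g) (λ gs → product (Vec.map ρ gs) * Φ (g ∷ gs)))
             (cong (ρ g *_) (∑-vectors k (λ gs → Φ (g ∷ gs)))))))

  𝔼ᵏ-cong : ∀ k {Φ Ψ} → (∀ gs → Φ gs ≡ Ψ gs) → 𝔼ᵏ ρ k Φ ≡ 𝔼ᵏ ρ k Ψ
  𝔼ᵏ-cong zero    Φ≡Ψ = Φ≡Ψ []
  𝔼ᵏ-cong (suc k) Φ≡Ψ = 𝔼-cong ρ (λ g → 𝔼ᵏ-cong k (λ gs → Φ≡Ψ (g ∷ gs)))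

  𝔼ᵏ-+ : ∀ k Φ Ψ → 𝔼ᵏ ρ k (λ gs → Φ gs + Ψ gs) ≡ 𝔼ᵏ ρ k Φ + 𝔼ᵏ ρ k Ψ
  𝔼ᵏ-+ zero    Φ Ψ = refl
  𝔼ᵏ-+ (suc k) Φ Ψ = trans
    (𝔼-cong ρ (λ g → 𝔼ᵏ-+ k (λ gs → Φ (g ∷ gs)) (λ gs → Ψ (g ∷ gs))))
    (𝔼-+ ρ (λ g → 𝔼ᵏ ρ k (λ gs → Φ (g ∷ gs))) (λ g → 𝔼ᵏ ρ k (λ gs → Ψ (g ∷ gs))))

  𝔼ᵏ-*ˡ : ∀ k c Φ → 𝔼ᵏ ρ k (λ gs → c * Φ gs) ≡ c * 𝔼ᵏ ρ k Φ
  𝔼ᵏ-*ˡ zero    c Φ = refl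
  𝔼ᵏ-*ˡ (suc k) c Φ = trans
    (𝔼-cong ρ (λ g → 𝔼ᵏ-*ˡ k c (λ gs → Φ (g ∷ gs))))
    (𝔼-*ˡ ρ c (λ g → 𝔼ᵏ ρ k (λ gs → Φ (g ∷ gs))))

step-expand : ∀ {k n} (α : Connective k) (ρ : Mass n) f →
  step α ρ f ≡ ∑ (vectors (boolFuns n) k)
                 (λ gs → indicator (compose α gs ≗? f) * product (Vec.map ρ gs))
step-expand {k} {n} α ρ f =
  ∑-filter (λ gs → compose α gs ≗? f) (vectors (boolFuns n) k) (λ gs → product (Vec.map ρ gs))

-- The law of total expectation for one step of the growth process.
𝔼-step : ∀ {k n} (α : Connective k) (ρ : Mass n) {φ} → Respects φ →
         𝔼 (step α ρ) φ ≡ 𝔼ᵏ ρ k (λ gs → φ (compose α gs))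
𝔼-step {k} {n} α ρ {φ} φ-resp = begin
  𝔼 (step α ρ) φ
    ≡⟨ ∑-cong F (λ f → trans (cong (_* φ f) (step-expand α ρ f))
         (trans (*-comm _ (φ f)) (sym (∑-*ˡ V (φ f) _)))) ⟩
  ∑ F (λ f → ∑ V (λ gs → φ f * (ind gs f * w gs)))
    ≡⟨ ∑-swap F V (λ f gs → φ f * (ind gs f * w gs)) ⟩
  ∑ V (λ gs → ∑ F (λ f → φ f * (ind gs f * w gs)))
    ≡⟨ ∑-cong V (λ gs → trans
         (∑-cong F (λ f → solve 3 (λ p i w → p :* (i :* w) := w :* (i :* p)) refl (φ f) (ind gs f) (w gs)))
         (trans (∑-*ˡ F (w gs) (λ f → ind gs f * φ f))
                (cong (w gs *_) (∑-indicator (compose α gs) φ-resp)))) ⟩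
  ∑ V (λ gs → w gs * φ (compose α gs))
    ≡⟨ ∑-vectors ρ k (λ gs → φ (compose α gs)) ⟩
  𝔼ᵏ ρ k (λ gs → φ (compose α gs)) ∎
  where
  open ≡-Reasoning
  F = boolFuns n
  V = vectors (boolFuns n) k
  ind = λ gs f → indicator (compose α gs ≗? f)
  w = λ gs → product (Vec.map ρ gs)

module _ {n} {ρ : Mass n} (ρ-dist : IsDistribution ρ) where
  open IsDistribution ρ-dist using (total) renaming (nonNegative to 0≤ρ)

  𝔼-const : ∀ c → 𝔼 ρ (const c) ≡ c
  𝔼-const c = trans (∑-cong (boolFuns n) (λ f → *-comm (ρ f) c))
    (trans (∑-*ˡ (boolFuns n) c ρ) (trans (cong (c *_) total) (*-identityʳ c)))

  𝔼ᵏ-const : ∀ k c → 𝔼ᵏ ρ k (const c) ≡ c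
  𝔼ᵏ-const zero    c = refl
  𝔼ᵏ-const (suc k) c = trans (𝔼-cong ρ (λ g → 𝔼ᵏ-const k c)) (𝔼-const c)

  𝔼-mono : ∀ {φ ψ} → (∀ f → φ f ≤ ψ f) → 𝔼 ρ φ ≤ 𝔼 ρ ψ
  𝔼-mono φ≤ψ = ∑-mono (boolFuns n) (λ f →
    *-monoˡ-≤-nonNeg (ρ f) {{nonNegative (0≤ρ f)}} (φ≤ψ f))

  𝔼-abs≤ : ∀ {φ ψ} → (∀ f → ∣ φ f ∣ ≤ ψ f) → ∣ 𝔼 ρ φ ∣ ≤ 𝔼 ρ ψ
  𝔼-abs≤ {φ} {ψ} φ≤ψ = ∣∣≤ (𝔼-mono (λ f → ≤-trans (p≤∣p∣ (φ f)) (φ≤ψ f)))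
    (subst (_≤ 𝔼 ρ ψ) (trans (𝔼-*ˡ ρ (- 1ℚ) φ) (sym (neg-mul (𝔼 ρ φ))))
      (𝔼-mono (λ f → subst (_≤ ψ f) (neg-mul (φ f)) (≤-trans (-p≤∣p∣ (φ f)) (φ≤ψ f)))))
    where
    neg-mul : ∀ p → - p ≡ - 1ℚ * p
    neg-mul = solve 1 (λ p → :- p := con (- 1ℚ) :* p) refl

  𝔼-abs≤1 : ∀ {φ} → (∀ f → ∣ φ f ∣ ≤ 1ℚ) → ∣ 𝔼 ρ φ ∣ ≤ 1ℚ
  𝔼-abs≤1 {φ} φ≤1 = subst (∣ 𝔼 ρ φ ∣ ≤_) (𝔼-const 1ℚ) (𝔼-abs≤ φ≤1)

  𝔼ᵏ-abs≤1 : ∀ k {Φ} → (∀ gs → ∣ Φ gs ∣ ≤ 1ℚ) → ∣ 𝔼ᵏ ρ k Φ ∣ ≤ 1ℚ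
  𝔼ᵏ-abs≤1 zero    Φ≤1 = Φ≤1 []
  𝔼ᵏ-abs≤1 (suc k) Φ≤1 = 𝔼-abs≤1 (λ g → 𝔼ᵏ-abs≤1 k (λ gs → Φ≤1 (g ∷ gs)))

indicator-0≤ : ∀ {P : Set} (P? : Dec P) → 0ℚ ≤ indicator P?
indicator-0≤ P? with does P?
... | true  = 0≤1
... | false = ≤-refl

indicator-yes : ∀ {P : Set} (P? : Dec P) → P → indicator P? ≡ 1ℚ
indicator-yes P? p = cong (if_then 1ℚ else 0ℚ) (dec-true P? p)

indicator-no : ∀ {P : Set} (P? : Dec P) → ¬ P → indicator P? ≡ 0ℚ
indicator-no P? ¬p = cong (if_then 1ℚ else 0ℚ) (dec-false P? ¬p)

indicator-⇔ : ∀ {P Q : Set} (P? : Dec P) (Q? : Dec Q) → (P → Q) → (Q → P) →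
              indicator P? ≡ indicator Q?
indicator-⇔ (yes p) Q? P→Q Q→P = sym (indicator-yes Q? (P→Q p))
indicator-⇔ (no ¬p) Q? P→Q Q→P = sym (indicator-no Q? (¬p ∘ Q→P))

≗-trans : ∀ {n} {f g h : BoolFun n} → f ≗ g → g ≗ h → f ≗ h
≗-trans e e′ a = trans (e a) (e′ a)

product-0≤ : ∀ {k n} {ρ : Mass n} → IsDistribution ρ → (gs : Vec (BoolFun n) k) →
             0ℚ ≤ product (Vec.map ρ gs)
product-0≤ ρ-dist []       = 0≤1
product-0≤ ρ-dist (g ∷ gs) =
  0≤* (IsDistribution.nonNegative ρ-dist g) (product-0≤ ρ-dist gs)

step-isDistribution : ∀ {k n} (α : Connective k) {ρ : Mass n} →
                      IsDistribution ρ → IsDistribution (step α ρ)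
step-isDistribution {k} {n} α {ρ} ρ-dist = record
  { resp = λ {f} {g} f≗g → trans (step-expand α ρ f) (trans
      (∑-cong (vectors (boolFuns n) k) (λ gs → cong (_* product (Vec.map ρ gs))
        (indicator-⇔ (compose α gs ≗? f) (compose α gs ≗? g)
          (λ e → ≗-trans e f≗g) (λ e → ≗-trans e (sym ∘ f≗g)))))
      (sym (step-expand α ρ g)))
  ; nonNegative = λ f → subst (0ℚ ≤_) (sym (step-expand α ρ f))
      (∑-0≤ (vectors (boolFuns n) k) (λ gs →
        0≤* (indicator-0≤ (compose α gs ≗? f)) (product-0≤ ρ-dist gs)))
  ; total = trans (∑-cong (boolFuns n) (λ f → sym (*-identityʳ (step α ρ f))))
      (trans (𝔼-step α ρ {const 1ℚ} (λ _ → refl)) (𝔼ᵏ-const ρ-dist k 1ℚ))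
  }

growth-isDistribution : ∀ {k n} (α : Connective k) {μ : Mass n} →
                        IsDistribution μ → ∀ i → IsDistribution (growth μ α i)
growth-isDistribution α μ-dist zero    = μ-dist
growth-isDistribution α μ-dist (suc i) =
  step-isDistribution α (growth-isDistribution α μ-dist i)

-- Characters

-- The sign encoding of bits, with true as 1.
χ : Bool → ℚ
χ true  = 1ℚ
χ false = - 1ℚ

∣χ∣ : ∀ b → ∣ χ b ∣ ≡ 1ℚ
∣χ∣ true  = refl
∣χ∣ false = refl

χ² : ∀ b → χ b * χ b ≡ 1ℚ
χ² true  = refl
χ² false = refl

-- The product of χ (f a) over the assignments a in a list.
character : ∀ {n} → List (Assignment n) → BoolFun n → ℚ
character []      f = 1ℚ
character (a ∷ T) f = χ (f a) * character T f

∣character∣≤1 : ∀ {n} (T : List (Assignment n)) f → ∣ character T f ∣ ≤ 1ℚ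
∣character∣≤1 []      f = ≤-refl
∣character∣≤1 (a ∷ T) f = ∣*∣≤1 {χ (f a)} (≤-reflexive (∣χ∣ (f a))) (∣character∣≤1 T f)

character-resp : ∀ {n} (T : List (Assignment n)) → Respects (character T)
character-resp []      f≗g = refl
character-resp (a ∷ T) f≗g = cong₂ _*_ (cong χ (f≗g a)) (character-resp T f≗g)

-- The joint correlation of the values of a random function with law ρ at the
-- assignments in T.
corr : ∀ {n} → Mass n → List (Assignment n) → ℚ
corr ρ T = 𝔼 ρ (character T)

∣corr∣≤1 : ∀ {n} {ρ : Mass n} → IsDistribution ρ → ∀ T → ∣ corr ρ T ∣ ≤ 1ℚ
∣corr∣≤1 ρ-dist T = 𝔼-abs≤1 ρ-dist (∣character∣≤1 T)

-- The effect of one growth step on correlations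

RealFun : ℕ → Set
RealFun k = Vec Bool k → ℚ

Bounded : ∀ {k} → RealFun k → Set
Bounded h = ∀ x → ∣ h x ∣ ≤ 1ℚ

-- The two coefficients of h as an affine function of χ of its first argument.
_⁺ _⁻ : ∀ {k} → RealFun (suc k) → RealFun k
(h ⁺) x = ½ * (h (true ∷ x) + h (false ∷ x))
(h ⁻) x = ½ * (h (true ∷ x) - h (false ∷ x))

affine : ∀ {k} (h : RealFun (suc k)) b x → h (b ∷ x) ≡ (h ⁺) x + χ b * (h ⁻) x
affine h true  x = solve 2 (λ t f → t := con ½ :* (t :+ f) :+ con 1ℚ :* (con ½ :* (t :- f))) refl
  (h (true ∷ x)) (h (false ∷ x))
affine h false x = solve 2 (λ t f → f := con ½ :* (t :+ f) :+ con (- 1ℚ) :* (con ½ :* (t :- f))) refl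
  (h (true ∷ x)) (h (false ∷ x))

⁺-bounded : ∀ {k} {h : RealFun (suc k)} → Bounded h → Bounded (h ⁺)
⁺-bounded {h = h} b x = ∣∣≤
  (≤-from (0≤* 0≤½ (0≤+ (0≤- (≤-trans (p≤∣p∣ t) (b _))) (0≤- (≤-trans (p≤∣p∣ f) (b _)))))
    (solve 2 (λ t f → con 1ℚ := con ½ :* (t :+ f) :+ con ½ :* ((con 1ℚ :- t) :+ (con 1ℚ :- f))) refl t f))
  (≤-from (0≤* 0≤½ (0≤+ (0≤- (≤-trans (-p≤∣p∣ t) (b _))) (0≤- (≤-trans (-p≤∣p∣ f) (b _)))))
    (solve 2 (λ t f → con 1ℚ := :- (con ½ :* (t :+ f)) :+ con ½ :* ((con 1ℚ :- :- t) :+ (con 1ℚ :- :- f))) refl t f))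
  where
  t = h (true ∷ x)
  f = h (false ∷ x)

⁻-bounded : ∀ {k} {h : RealFun (suc k)} → Bounded h → Bounded (h ⁻)
⁻-bounded {h = h} b x = ∣∣≤
  (≤-from (0≤* 0≤½ (0≤+ (0≤- (≤-trans (p≤∣p∣ t) (b _))) (0≤- (≤-trans (-p≤∣p∣ f) (b _)))))
    (solve 2 (λ t f → con 1ℚ := con ½ :* (t :- f) :+ con ½ :* ((con 1ℚ :- t) :+ (con 1ℚ :- :- f))) refl t f))
  (≤-from (0≤* 0≤½ (0≤+ (0≤- (≤-trans (-p≤∣p∣ t) (b _))) (0≤- (≤-trans (p≤∣p∣ f) (b _)))))
    (solve 2 (λ t f → con 1ℚ := :- (con ½ :* (t :- f)) :+ con ½ :* ((con 1ℚ :- :- t) :+ (con 1ℚ :- f))) refl t f))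
  where
  t = h (true ∷ x)
  f = h (false ∷ x)

-- With ĥ(T) denoting the Fourier coefficients of h, the sum of ĥ(T) ^ r * c ^ ∣T∣
-- over all sets T of coordinates, computed one coordinate at a time. For r = 1
-- it is the multilinear extension of h, for r = 2 its noise stability.
stab : ℕ → ∀ k → RealFun k → ℚ → ℚ
stab r zero    h c = h [] ^ r
stab r (suc k) h c = stab r k (h ⁺) c + c * stab r k (h ⁻) c

-- The k bits that k functions take at an assignment.
eval : ∀ {k n} → Vec (BoolFun n) k → Assignment n → Vec Bool k
eval gs a = Vec.map (λ g → g a) gs

-- The product over the assignments a in T of h evaluated at the bits gs a.
monomial : ∀ {k n} → RealFun k → List (Assignment n) → Vec (BoolFun n) k → ℚ
monomial h []      gs = 1ℚ
monomial h (a ∷ T) gs = h (eval gs a) * monomial h T gs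

monomial-[] : ∀ {n} (h : RealFun 0) (T : List (Assignment n)) → monomial h T [] ≡ h [] ^ length T
monomial-[] h []      = refl
monomial-[] h (a ∷ T) = cong (h [] *_) (monomial-[] h T)

character-compose : ∀ {k n} (α : Connective k) (T : List (Assignment n)) gs →
                    character T (compose α gs) ≡ monomial (χ ∘ α) T gs
character-compose α []      gs = refl
character-compose α (a ∷ T) gs = cong (χ (α (eval gs a)) *_) (character-compose α T gs)

corr-step : ∀ {k n} (α : Connective k) (ρ : Mass n) T →
            corr (step α ρ) T ≡ 𝔼ᵏ ρ k (monomial (χ ∘ α) T)
corr-step {k} α ρ T = trans (𝔼-step α ρ (character-resp T))
                            (𝔼ᵏ-cong ρ k (character-compose α T))

-- A class of negligible sequences: an ideal with respect to multiplication by
-- sequences bounded by 1. The two instances used are the null sequences and the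
-- zero sequence; the latter turns approximate recursions into exact ones.
record Ideal (N : (ℕ → ℚ) → Set) : Set where
  field
    N-cong  : ∀ {x y : ℕ → ℚ} → (∀ i → x i ≡ y i) → N x → N y
    N-0     : N (const 0ℚ)
    N-+     : ∀ {x y : ℕ → ℚ} → N x → N y → N (λ i → x i + y i)
    N-*     : ∀ {x y : ℕ → ℚ} → N x → (∀ i → ∣ y i ∣ ≤ 1ℚ) → N (λ i → x i * y i)

null-ideal : Ideal (λ x → Converges x 0ℚ)
null-ideal = record
  { N-cong = ⟶-cong
  ; N-0    = ⟶-const 0ℚ
  ; N-+    = ⟶-+
  ; N-*    = λ {x} {y} x0 y≤1 → ⟶0-dominated (λ i → ∣*∣≤∣∣ (x i) (y≤1 i)) x0
  }

zero-ideal : Ideal (λ x → ∀ i → x i ≡ 0ℚ)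
zero-ideal = record
  { N-cong = λ x≡y x0 i → trans (sym (x≡y i)) (x0 i)
  ; N-0    = λ i → refl
  ; N-+    = λ x0 y0 i → cong₂ _+_ (x0 i) (y0 i)
  ; N-*    = λ {x} {y} x0 _ i → trans (cong (_* y i) (x0 i)) (*-zeroˡ (y i))
  }

-- One step of the recursion for the correlation over S, when the correlations
-- over all proper nonempty parts of S are negligible.
module Expansion
  {n} {ρ : ℕ → Mass n} (ρ-dist : ∀ i → IsDistribution (ρ i))
  {N} (N-ideal : Ideal N)
  {S : List (Assignment n)}
  (proper : ∀ t T u U → (t ∷ T) ++ (u ∷ U) ↭ S → N (λ i → corr (ρ i) (t ∷ T)))
  where

  open Ideal N-ideal

  infix 4 _≈_

  -- Equality up to a negligible sequence.
  record _≈_ (x y : ℕ → ℚ) : Set where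
    constructor mk≈
    field difference : N (λ i → x i - y i)

  open _≈_ public

  ≈-reflexive : ∀ {x y} → (∀ i → x i ≡ y i) → x ≈ y
  ≈-reflexive {x} {y} x≡y .difference = N-cong {const 0ℚ}
    (λ i → sym (trans (cong (_- y i) (x≡y i)) (+-inverseʳ (y i)))) N-0

  ≈-trans : ∀ {x y z} → x ≈ y → y ≈ z → x ≈ z
  ≈-trans {x} {y} {z} x≈y y≈z .difference = N-cong
    (λ i → solve 3 (λ x y z → (x :- y) :+ (y :- z) := x :- z) refl (x i) (y i) (z i))
    (N-+ (x≈y .difference) (y≈z .difference))

  ≈-+ : ∀ {x x′ y y′} → x ≈ x′ → y ≈ y′ → (λ i → x i + y i) ≈ (λ i → x′ i + y′ i)
  ≈-+ {x} {x′} {y} {y′} p q .difference = N-cong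
    (λ i → solve 4 (λ x x′ y y′ → (x :- x′) :+ (y :- y′) := (x :+ y) :- (x′ :+ y′)) refl (x i) (x′ i) (y i) (y′ i))
    (N-+ (p .difference) (q .difference))

  ≈-* : ∀ (c : ℕ → ℚ) {x y} → (∀ i → ∣ c i ∣ ≤ 1ℚ) → x ≈ y → (λ i → c i * x i) ≈ (λ i → c i * y i)
  ≈-* c {x} {y} c≤1 p .difference = N-cong
    (λ i → solve 3 (λ c x y → (x :- y) :* c := c :* x :- c :* y) refl (c i) (x i) (y i))
    (N-* {y = c} (p .difference) c≤1)

  ∈N⇒≈0 : ∀ {x} → N x → x ≈ const 0ℚ
  ∈N⇒≈0 {x} x∈N .difference = N-cong (λ i → sym (p-0≡p (x i))) x∈N

  module _ {k} {h : RealFun (suc k)} (h-bdd : Bounded h) where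

    -- The state of an expansion of the factors h (eval (g ∷ gs) a), a in S, in the
    -- signs χ (g a): the factors at T have contributed χ (g a) and a coefficient in Ψ,
    -- other treated factors only a coefficient in Ψ, and those at W are untreated.
    partial : List (Assignment n) → (Vec (BoolFun n) k → ℚ) → List (Assignment n) → ℕ → ℚ
    partial T Ψ W i = 𝔼 (ρ i) (λ g → character T g * 𝔼ᵏ (ρ i) k (λ gs → Ψ gs * monomial h W (g ∷ gs)))

    BoundedΨ : (Vec (BoolFun n) k → ℚ) → Set
    BoundedΨ Ψ = ∀ gs → ∣ Ψ gs ∣ ≤ 1ℚ

    Ψ⁺ Ψ⁻ : (Vec (BoolFun n) k → ℚ) → Assignment n → Vec (BoolFun n) k → ℚ
    Ψ⁺ Ψ a gs = Ψ gs * (h ⁺) (eval gs a)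
    Ψ⁻ Ψ a gs = Ψ gs * (h ⁻) (eval gs a)

    Ψ⁺-bdd : ∀ {Ψ} → BoundedΨ Ψ → ∀ a → BoundedΨ (Ψ⁺ Ψ a)
    Ψ⁺-bdd {Ψ} b a gs = ∣*∣≤1 {Ψ gs} (b gs) (⁺-bounded {h = h} h-bdd (eval gs a))

    Ψ⁻-bdd : ∀ {Ψ} → BoundedΨ Ψ → ∀ a → BoundedΨ (Ψ⁻ Ψ a)
    Ψ⁻-bdd {Ψ} b a gs = ∣*∣≤1 {Ψ gs} (b gs) (⁻-bounded {h = h} h-bdd (eval gs a))

    partial-split : ∀ T Ψ a W i →
      partial T Ψ (a ∷ W) i ≡ partial T (Ψ⁺ Ψ a) W i + partial (a ∷ T) (Ψ⁻ Ψ a) W i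
    partial-split T Ψ a W i = trans
      (𝔼-cong (ρ i) (λ g → trans
        (cong (character T g *_) (trans
          (𝔼ᵏ-cong (ρ i) k (λ gs → trans
            (cong (λ z → Ψ gs * (z * monomial h W (g ∷ gs))) (affine h (g a) (eval gs a)))
            (solve 5 (λ p s t c m → p :* ((s :+ c :* t) :* m) := p :* s :* m :+ c :* (p :* t :* m)) refl
              (Ψ gs) ((h ⁺) (eval gs a)) ((h ⁻) (eval gs a)) (χ (g a)) (monomial h W (g ∷ gs)))))
          (trans (𝔼ᵏ-+ (ρ i) k (λ gs → Ψ⁺ Ψ a gs * monomial h W (g ∷ gs))
                               (λ gs → χ (g a) * (Ψ⁻ Ψ a gs * monomial h W (g ∷ gs))))
            (cong (𝔼ᵏ (ρ i) k (λ gs → Ψ⁺ Ψ a gs * monomial h W (g ∷ gs)) +_)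
              (𝔼ᵏ-*ˡ (ρ i) k (χ (g a)) (λ gs → Ψ⁻ Ψ a gs * monomial h W (g ∷ gs)))))))
        (solve 4 (λ t c x y → t :* (x :+ c :* y) := t :* x :+ c :* t :* y) refl
          (character T g) (χ (g a))
          (𝔼ᵏ (ρ i) k (λ gs → Ψ⁺ Ψ a gs * monomial h W (g ∷ gs)))
          (𝔼ᵏ (ρ i) k (λ gs → Ψ⁻ Ψ a gs * monomial h W (g ∷ gs))))))
      (𝔼-+ (ρ i) (λ g → character T g * 𝔼ᵏ (ρ i) k (λ gs → Ψ⁺ Ψ a gs * monomial h W (g ∷ gs)))
                 (λ g → character (a ∷ T) g * 𝔼ᵏ (ρ i) k (λ gs → Ψ⁻ Ψ a gs * monomial h W (g ∷ gs))))

    partial-[] : ∀ T Ψ i → partial T Ψ [] i ≡ corr (ρ i) T * 𝔼ᵏ (ρ i) k Ψ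
    partial-[] T Ψ i = trans
      (𝔼-cong (ρ i) (λ g → trans
        (cong (character T g *_) (𝔼ᵏ-cong (ρ i) k (λ gs → *-identityʳ (Ψ gs))))
        (*-comm (character T g) (𝔼ᵏ (ρ i) k Ψ))))
      (trans (𝔼-*ˡ (ρ i) (𝔼ᵏ (ρ i) k Ψ) (character T)) (*-comm (𝔼ᵏ (ρ i) k Ψ) (corr (ρ i) T)))

    shiftʳ : ∀ (T U : List (Assignment n)) a W → T ++ (a ∷ U) ++ W ↭ T ++ U ++ (a ∷ W)
    shiftʳ T U a W = ++⁺ˡ T (↭-sym (shift a U W))

    shiftˡ : ∀ (T : List (Assignment n)) a W → (a ∷ T) ++ W ↭ T ++ (a ∷ W)
    shiftˡ T a W = ↭-sym (shift a T W)

    -- Once the new function g has entered through some but not all of the treated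
    -- factors, only negligible correlations can result.
    partial-mixed : ∀ W t T u U {Ψ} → BoundedΨ Ψ → (t ∷ T) ++ (u ∷ U) ++ W ↭ S →
                    N (partial (t ∷ T) Ψ W)
    partial-mixed [] t T u U {Ψ} b p = N-cong (λ i → sym (partial-[] (t ∷ T) Ψ i))
      (N-* {y = λ i → 𝔼ᵏ (ρ i) k Ψ} (proper t T u U (↭-trans (↭-reflexive (cong ((t ∷ T) ++_) (sym (++-identityʳ (u ∷ U))))) p))
           (λ i → 𝔼ᵏ-abs≤1 (ρ-dist i) k b))
    partial-mixed (a ∷ W) t T u U {Ψ} b p = N-cong (λ i → sym (partial-split (t ∷ T) Ψ a W i))
      (N-+ (partial-mixed W t T a (u ∷ U) (Ψ⁺-bdd b a) (↭-trans (shiftʳ (t ∷ T) (u ∷ U) a W) p))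
           (partial-mixed W a (t ∷ T) u U (Ψ⁻-bdd b a)
             (↭-trans (shiftˡ (t ∷ T) a ((u ∷ U) ++ W)) (↭-trans (shiftʳ (t ∷ T) (u ∷ U) a W) p))))

    -- If some factor has left g out, then up to negligible terms all others do too.
    partial-⁺ : ∀ W u U {Ψ} → BoundedΨ Ψ → (u ∷ U) ++ W ↭ S →
                partial [] Ψ W ≈ λ i → 𝔼ᵏ (ρ i) k (λ gs → Ψ gs * monomial (h ⁺) W gs)
    partial-⁺ [] u U {Ψ} b p = ≈-reflexive (λ i → trans (partial-[] [] Ψ i)
      (trans (cong (_* 𝔼ᵏ (ρ i) k Ψ) (𝔼-const (ρ-dist i) 1ℚ)) (trans (*-identityˡ _)
        (𝔼ᵏ-cong (ρ i) k (λ gs → sym (*-identityʳ (Ψ gs)))))))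
    partial-⁺ (a ∷ W) u U {Ψ} b p =
      ≈-trans (≈-reflexive (partial-split [] Ψ a W))
      (≈-trans (≈-+ (partial-⁺ W a (u ∷ U) (Ψ⁺-bdd b a) (↭-trans (shiftˡ (u ∷ U) a W) p))
                    (∈N⇒≈0 (partial-mixed W a [] u U (Ψ⁻-bdd b a) (↭-trans (shiftˡ (u ∷ U) a W) p))))
        (≈-reflexive (λ i → trans (+-identityʳ _)
          (𝔼ᵏ-cong (ρ i) k (λ gs → *-assoc (Ψ gs) ((h ⁺) (eval gs a)) (monomial (h ⁺) W gs))))))

    -- If some factor has used g, then up to negligible terms all others do too.
    partial-⁻ : ∀ W t T {Ψ} → BoundedΨ Ψ → (t ∷ T) ++ W ↭ S →
                partial (t ∷ T) Ψ W ≈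
                λ i → 𝔼 (ρ i) (λ g → character (t ∷ T) g * character W g) *
                      𝔼ᵏ (ρ i) k (λ gs → Ψ gs * monomial (h ⁻) W gs)
    partial-⁻ [] t T {Ψ} b p = ≈-reflexive (λ i → trans (partial-[] (t ∷ T) Ψ i)
      (cong₂ _*_ (𝔼-cong (ρ i) (λ g → sym (*-identityʳ (character (t ∷ T) g))))
                 (𝔼ᵏ-cong (ρ i) k (λ gs → sym (*-identityʳ (Ψ gs))))))
    partial-⁻ (a ∷ W) t T {Ψ} b p =
      ≈-trans (≈-reflexive (partial-split (t ∷ T) Ψ a W))
      (≈-trans (≈-+ (∈N⇒≈0 (partial-mixed W t T a [] (Ψ⁺-bdd b a) p))
                    (partial-⁻ W a (t ∷ T) (Ψ⁻-bdd b a) (↭-trans (shiftˡ (t ∷ T) a W) p)))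
        (≈-reflexive (λ i → trans (+-identityˡ _)
          (cong₂ _*_
            (𝔼-cong (ρ i) (λ g → solve 3 (λ c t w → c :* t :* w := t :* (c :* w)) refl
              (χ (g a)) (character (t ∷ T) g) (character W g)))
            (𝔼ᵏ-cong (ρ i) k (λ gs → *-assoc (Ψ gs) ((h ⁻) (eval gs a)) (monomial (h ⁻) W gs)))))))

    recursion : ∀ {s R} → s ∷ R ≡ S →
      (λ i → 𝔼ᵏ (ρ i) (suc k) (monomial h S)) ≈
      (λ i → 𝔼ᵏ (ρ i) k (monomial (h ⁺) S) + corr (ρ i) S * 𝔼ᵏ (ρ i) k (monomial (h ⁻) S))
    recursion {s} {R} refl =
      ≈-trans (≈-reflexive (λ i → trans
        (𝔼-cong (ρ i) (λ g → sym (trans (*-identityˡ _)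
          (𝔼ᵏ-cong (ρ i) k (λ gs → *-identityˡ (monomial h S (g ∷ gs)))))))
        (partial-split [] (const 1ℚ) s R i)))
      (≈-trans (≈-+ (partial-⁺ R s [] (Ψ⁺-bdd (λ _ → ≤-refl) s) ↭-refl)
                    (partial-⁻ R s [] (Ψ⁻-bdd (λ _ → ≤-refl) s) ↭-refl))
        (≈-reflexive (λ i → cong₂ _+_
          (𝔼ᵏ-cong (ρ i) k (λ gs → cong (_* monomial (h ⁺) R gs) (*-identityˡ ((h ⁺) (eval gs s)))))
          (cong₂ _*_
            (𝔼-cong (ρ i) (λ g → cong (_* character R g) (*-identityʳ (χ (g s)))))
            (𝔼ᵏ-cong (ρ i) k (λ gs → cong (_* monomial (h ⁻) R gs) (*-identityˡ ((h ⁻) (eval gs s)))))))))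

  -- Only the terms in which all factors use the same set of arguments survive.
  expansion : ∀ {s R} → s ∷ R ≡ S → ∀ k {h : RealFun k} → Bounded h →
    (λ i → 𝔼ᵏ (ρ i) k (monomial h S)) ≈ (λ i → stab (length S) k h (corr (ρ i) S))
  expansion S≢[] zero    {h} b = ≈-reflexive (λ i → monomial-[] h S)
  expansion S≢[] (suc k) {h} b = ≈-trans (recursion b S≢[])
    (≈-+ (expansion S≢[] k (⁺-bounded {h = h} b))
         (≈-* (λ i → corr (ρ i) S) (λ i → ∣corr∣≤1 (ρ-dist i) S) (expansion S≢[] k (⁻-bounded {h = h} b))))

-- Multilinear extensions

-- The expectation of h at independent random bits with 𝔼 χ = y.
ext : ∀ k → RealFun k → ℚ → ℚ
ext zero    h y = h []
ext (suc k) h y = ½ * ((1ℚ - y) * ext k (h ∘ (false ∷_)) y + (1ℚ + y) * ext k (h ∘ (true ∷_)) y)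

-- The expectation of h at uniform random bits.
mean : ∀ k → RealFun k → ℚ
mean k h = ext k h 0ℚ

ext-cong : ∀ k {g h : RealFun k} y → (∀ x → g x ≡ h x) → ext k g y ≡ ext k h y
ext-cong zero    y g≡h = g≡h []
ext-cong (suc k) y g≡h = cong₂ (λ p q → ½ * ((1ℚ - y) * p + (1ℚ + y) * q))
  (ext-cong k y (g≡h ∘ (false ∷_))) (ext-cong k y (g≡h ∘ (true ∷_)))

ext-linear : ∀ k (g h : RealFun k) b c y →
             ext k (λ x → b * g x + c * h x) y ≡ b * ext k g y + c * ext k h y
ext-linear zero    g h b c y = refl
ext-linear (suc k) g h b c y = trans
  (cong₂ (λ p q → ½ * ((1ℚ - y) * p + (1ℚ + y) * q))
    (ext-linear k (g ∘ (false ∷_)) (h ∘ (false ∷_)) b c y)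
    (ext-linear k (g ∘ (true ∷_)) (h ∘ (true ∷_)) b c y))
  (solve 7 (λ b c y g₀ h₀ g₁ h₁ →
      con ½ :* ((con 1ℚ :- y) :* (b :* g₀ :+ c :* h₀) :+ (con 1ℚ :+ y) :* (b :* g₁ :+ c :* h₁)) :=
      b :* (con ½ :* ((con 1ℚ :- y) :* g₀ :+ (con 1ℚ :+ y) :* g₁)) :+
      c :* (con ½ :* ((con 1ℚ :- y) :* h₀ :+ (con 1ℚ :+ y) :* h₁)))
    refl b c y _ _ _ _)

ext-const : ∀ k c y → ext k (const c) y ≡ c
ext-const zero    c y = refl
ext-const (suc k) c y = trans
  (cong₂ (λ p q → ½ * ((1ℚ - y) * p + (1ℚ + y) * q)) (ext-const k c y) (ext-const k c y))
  (solve 2 (λ c y → con ½ :* ((con 1ℚ :- y) :* c :+ (con 1ℚ :+ y) :* c) := c) refl c y)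

ext-⁺ : ∀ k (h : RealFun (suc k)) y →
        ext k (h ⁺) y ≡ ½ * (ext k (h ∘ (true ∷_)) y + ext k (h ∘ (false ∷_)) y)
ext-⁺ k h y = trans
  (ext-cong k y (λ x → *-distribˡ-+ ½ (h (true ∷ x)) (h (false ∷ x))))
  (trans (ext-linear k (h ∘ (true ∷_)) (h ∘ (false ∷_)) ½ ½ y)
         (sym (*-distribˡ-+ ½ (ext k (h ∘ (true ∷_)) y) (ext k (h ∘ (false ∷_)) y))))

ext-⁻ : ∀ k (h : RealFun (suc k)) y →
        ext k (h ⁻) y ≡ ½ * (ext k (h ∘ (true ∷_)) y - ext k (h ∘ (false ∷_)) y)
ext-⁻ k h y = trans
  (ext-cong k y (λ x → solve 2 (λ t f → con ½ :* (t :- f) := con ½ :* t :+ con (- ½) :* f) refl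
    (h (true ∷ x)) (h (false ∷ x))))
  (trans (ext-linear k (h ∘ (true ∷_)) (h ∘ (false ∷_)) ½ (- ½) y)
    (solve 2 (λ t f → con ½ :* t :+ con (- ½) :* f := con ½ :* (t :- f)) refl
      (ext k (h ∘ (true ∷_)) y) (ext k (h ∘ (false ∷_)) y)))

stab₁≡ext : ∀ k (h : RealFun k) y → stab 1 k h y ≡ ext k h y
stab₁≡ext zero    h y = *-identityʳ (h [])
stab₁≡ext (suc k) h y = trans
  (cong₂ (λ p q → p + y * q) (trans (stab₁≡ext k (h ⁺) y) (ext-⁺ k h y))
                             (trans (stab₁≡ext k (h ⁻) y) (ext-⁻ k h y)))
  (solve 3 (λ y t f → con ½ :* (t :+ f) :+ y :* (con ½ :* (t :- f)) :=
                      con ½ :* ((con 1ℚ :- y) :* f :+ (con 1ℚ :+ y) :* t)) refl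
    y (ext k (h ∘ (true ∷_)) y) (ext k (h ∘ (false ∷_)) y))

mean-suc : ∀ k (h : RealFun (suc k)) → mean (suc k) h ≡ mean k (h ⁺)
mean-suc k h = trans
  (solve 2 (λ t f → con ½ :* ((con 1ℚ :- con 0ℚ) :* f :+ (con 1ℚ :+ con 0ℚ) :* t) := con ½ :* (t :+ f)) refl
    (mean k (h ∘ (true ∷_))) (mean k (h ∘ (false ∷_))))
  (sym (ext-⁺ k h 0ℚ))

-- Harnack's inequality for the multilinear extension of a nonnegative function.
ext-harnack : ∀ k {h : RealFun k} {y z} → 0ℚ ≤ z → z ≤ 1ℚ - y → z ≤ 1ℚ + y →
              (∀ x → 0ℚ ≤ h x) → z ^ k * mean k h ≤ ext k h y
ext-0≤ : ∀ k {h : RealFun k} {y} → 0ℚ ≤ 1ℚ - y → 0ℚ ≤ 1ℚ + y → (∀ x → 0ℚ ≤ h x) → 0ℚ ≤ ext k h y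

ext-0≤ zero    _  _  0≤h = 0≤h []
ext-0≤ (suc k) y≤ ≤y 0≤h = 0≤* 0≤½ (0≤+ (0≤* y≤ (ext-0≤ k y≤ ≤y (0≤h ∘ (false ∷_))))
                                        (0≤* ≤y (ext-0≤ k y≤ ≤y (0≤h ∘ (true ∷_)))))

ext-harnack zero    {h} 0≤z _ _ 0≤h = ≤-reflexive (*-identityˡ (h []))
ext-harnack (suc k) {h} {y} {z} 0≤z z≤1-y z≤1+y 0≤h = ≤-from
  (0≤* 0≤½ (0≤+ (0≤+ (0≤* (0≤- z≤1-y) (ext-0≤ k 0≤1-y 0≤1+y (0≤h ∘ (false ∷_))))
                     (0≤* 0≤z (0≤- (ext-harnack k 0≤z z≤1-y z≤1+y (0≤h ∘ (false ∷_))))))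
                (0≤+ (0≤* (0≤- z≤1+y) (ext-0≤ k 0≤1-y 0≤1+y (0≤h ∘ (true ∷_))))
                     (0≤* 0≤z (0≤- (ext-harnack k 0≤z z≤1-y z≤1+y (0≤h ∘ (true ∷_))))))))
  (solve 7 (λ y z p f t m₀ m₁ →
      con ½ :* ((con 1ℚ :- y) :* f :+ (con 1ℚ :+ y) :* t) :=
      z :* p :* (con ½ :* ((con 1ℚ :- con 0ℚ) :* m₀ :+ (con 1ℚ :+ con 0ℚ) :* m₁)) :+
      con ½ :* (((con 1ℚ :- y :- z) :* f :+ z :* (f :- p :* m₀)) :+
                ((con 1ℚ :+ y :- z) :* t :+ z :* (t :- p :* m₁))))
    refl y z (z ^ k) (ext k (h ∘ (false ∷_)) y) (ext k (h ∘ (true ∷_)) y)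
    (mean k (h ∘ (false ∷_))) (mean k (h ∘ (true ∷_))))
  where
  0≤1-y = ≤-trans 0≤z z≤1-y
  0≤1+y = ≤-trans 0≤z z≤1+y

ext-1- : ∀ k (h : RealFun k) y → ext k (λ x → 1ℚ - h x) y ≡ 1ℚ - ext k h y
ext-1- k h y = trans
  (ext-cong k y (λ x → solve 1 (λ h → con 1ℚ :- h := con 1ℚ :* con 1ℚ :+ con (- 1ℚ) :* h) refl (h x)))
  (trans (ext-linear k (const 1ℚ) h 1ℚ (- 1ℚ) y)
  (trans (cong (λ z → 1ℚ * z + - 1ℚ * ext k h y) (ext-const k 1ℚ y))
    (solve 1 (λ h → con 1ℚ :* con 1ℚ :+ con (- 1ℚ) :* h := con 1ℚ :- h) refl (ext k h y))))

ext-1+ : ∀ k (h : RealFun k) y → ext k (λ x → 1ℚ + h x) y ≡ 1ℚ + ext k h y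
ext-1+ k h y = trans
  (ext-cong k y (λ x → solve 1 (λ h → con 1ℚ :+ h := con 1ℚ :* con 1ℚ :+ con 1ℚ :* h) refl (h x)))
  (trans (ext-linear k (const 1ℚ) h 1ℚ 1ℚ y)
  (trans (cong (λ z → 1ℚ * z + 1ℚ * ext k h y) (ext-const k 1ℚ y))
    (solve 1 (λ h → con 1ℚ :* con 1ℚ :+ con 1ℚ :* h := con 1ℚ :+ h) refl (ext k h y))))

∣∣≤1 : ∀ {p} → 0ℚ ≤ 1ℚ - p → 0ℚ ≤ 1ℚ + p → ∣ p ∣ ≤ 1ℚ
∣∣≤1 {p} 0≤1-p 0≤1+p = ∣∣≤
  (≤-from 0≤1-p (solve 1 (λ p → con 1ℚ := p :+ (con 1ℚ :- p)) refl p))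
  (≤-from 0≤1+p (solve 1 (λ p → con 1ℚ := :- p :+ (con 1ℚ :+ p)) refl p))

∣ext∣≤1 : ∀ k {h : RealFun k} {y} → Bounded h → ∣ y ∣ ≤ 1ℚ → ∣ ext k h y ∣ ≤ 1ℚ
∣ext∣≤1 k {h} {y} h-bdd y≤ = ∣∣≤1
  (subst (0ℚ ≤_) (ext-1- k h y) (ext-0≤ k (0≤1-∣∣ y≤) (0≤1+∣∣ y≤) (λ x → 0≤1-∣∣ (h-bdd x))))
  (subst (0ℚ ≤_) (ext-1+ k h y) (ext-0≤ k (0≤1-∣∣ y≤) (0≤1+∣∣ y≤) (λ x → 0≤1+∣∣ (h-bdd x))))

∣mean∣≤1 : ∀ k {h : RealFun k} → Bounded h → ∣ mean k h ∣ ≤ 1ℚ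
∣mean∣≤1 k h-bdd = ∣ext∣≤1 k h-bdd 0≤1

mean-0≤ : ∀ k {h : RealFun k} → (∀ x → 0ℚ ≤ h x) → 0ℚ ≤ mean k h
mean-0≤ k = ext-0≤ k 0≤1 0≤1

mean≡0 : ∀ k {h : RealFun k} → (∀ x → 0ℚ ≤ h x) → mean k h ≡ 0ℚ → ∀ x → h x ≡ 0ℚ
mean≡0 zero    0≤h m≡0 [] = m≡0
mean≡0 (suc k) {h} 0≤h m≡0 = λ
  { (false ∷ x) → mean≡0 k (0≤h ∘ (false ∷_)) (≤-antisym (≤-from 0≤m₁ 0≡m₀+m₁) 0≤m₀) x
  ; (true  ∷ x) → mean≡0 k (0≤h ∘ (true ∷_)) (≤-antisym (≤-from 0≤m₀ (trans 0≡m₀+m₁ (+-comm m₀ m₁))) 0≤m₁) x }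
  where
  m₀ = mean k (h ∘ (false ∷_))
  m₁ = mean k (h ∘ (true ∷_))
  0≤m₀ = mean-0≤ k (0≤h ∘ (false ∷_))
  0≤m₁ = mean-0≤ k (0≤h ∘ (true ∷_))
  0≡m₀+m₁ : 0ℚ ≡ m₀ + m₁
  0≡m₀+m₁ = trans (sym (*-zeroʳ (1ℚ + 1ℚ))) (trans (cong ((1ℚ + 1ℚ) *_) (sym m≡0))
    (solve 2 (λ f t → con (1ℚ + 1ℚ) :* (con ½ :* ((con 1ℚ :- con 0ℚ) :* f :+ (con 1ℚ :+ con 0ℚ) :* t)) := f :+ t)
      refl m₀ m₁))

-- Fourier weights

stab-cong : ∀ r k {g h : RealFun k} c → (∀ x → g x ≡ h x) → stab r k g c ≡ stab r k h c
stab-cong r zero    c g≡h = cong (_^ r) (g≡h [])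
stab-cong r (suc k) c g≡h = cong₂ (λ p q → p + c * q)
  (stab-cong r k c (λ x → cong₂ (λ p q → ½ * (p + q)) (g≡h (true ∷ x)) (g≡h (false ∷ x))))
  (stab-cong r k c (λ x → cong₂ (λ p q → ½ * (p - q)) (g≡h (true ∷ x)) (g≡h (false ∷ x))))

stab-0 : ∀ r k c → stab (suc r) k (const 0ℚ) c ≡ 0ℚ
stab-0 r zero    c = *-zeroˡ (0ℚ ^ r)
stab-0 r (suc k) c = trans
  (cong₂ (λ p q → p + c * q) (stab-0 r k c) (stab-0 r k c))
  (solve 1 (λ c → con 0ℚ :+ c :* con 0ℚ := con 0ℚ) refl c)

-- The sum of the squares of all Fourier coefficients.
energy : ∀ k → RealFun k → ℚ
energy k h = stab 2 k h 1ℚ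

parseval : ∀ k (h : RealFun k) → energy k h ≡ mean k (λ x → h x * h x)
parseval zero    h = cong (h [] *_) (*-identityʳ (h []))
parseval (suc k) h = begin
  energy k (h ⁺) + 1ℚ * energy k (h ⁻)
    ≡⟨ cong₂ (λ p q → p + 1ℚ * q) (parseval k (h ⁺)) (parseval k (h ⁻)) ⟩
  mean k sq⁺ + 1ℚ * mean k sq⁻
    ≡⟨ cong (_+ 1ℚ * mean k sq⁻) (*-identityˡ (mean k sq⁺)) ⟨
  1ℚ * mean k sq⁺ + 1ℚ * mean k sq⁻
    ≡⟨ ext-linear k sq⁺ sq⁻ 1ℚ 1ℚ 0ℚ ⟨
  mean k (λ x → 1ℚ * sq⁺ x + 1ℚ * sq⁻ x)
    ≡⟨ ext-cong k 0ℚ (λ x → solve 2 (λ t f →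
         con 1ℚ :* ((con ½ :* (t :+ f)) :* (con ½ :* (t :+ f))) :+
         con 1ℚ :* ((con ½ :* (t :- f)) :* (con ½ :* (t :- f))) :=
         con ½ :* (t :* t :+ f :* f)) refl (h (true ∷ x)) (h (false ∷ x))) ⟩
  mean k ((λ x → h x * h x) ⁺)
    ≡⟨ mean-suc k (λ x → h x * h x) ⟨
  mean (suc k) (λ x → h x * h x) ∎
  where
  open ≡-Reasoning
  sq⁺ sq⁻ : RealFun k
  sq⁺ x = (h ⁺) x * (h ⁺) x
  sq⁻ x = (h ⁻) x * (h ⁻) x

mean²≤energy : ∀ k (h : RealFun k) → mean k h * mean k h ≤ energy k h
mean²≤energy zero    h = ≤-reflexive (cong (h [] *_) (sym (*-identityʳ (h []))))
mean²≤energy (suc k) h = subst (λ m → m * m ≤ energy (suc k) h) (sym (mean-suc k h))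
  (≤-from (0≤+ (0≤- (mean²≤energy k (h ⁺))) (≤-trans (0≤p² (mean k (h ⁻))) (mean²≤energy k (h ⁻))))
    (solve 3 (λ m p q → p :+ con 1ℚ :* q := m :* m :+ ((p :- m :* m) :+ q)) refl
      (mean k (h ⁺)) (energy k (h ⁺)) (energy k (h ⁻))))

∣p∣² : ∀ p → ∣ p ∣ * ∣ p ∣ ≡ p * p
∣p∣² p = trans (sym (∣p*q∣≡∣p∣*∣q∣ p p)) (0≤p⇒∣p∣≡p (0≤p² p))

-- The empty set contributes the power of the mean; every other term carries at
-- least one factor c, and its coefficient has power at most the square.
∣stab∣≤ : ∀ s k {h : RealFun k} {c} → Bounded h → ∣ c ∣ ≤ 1ℚ →
          ∣ stab (2 ℕ.+ s) k h c ∣ ≤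
          ∣ mean k h ∣ ^ (2 ℕ.+ s) + ∣ c ∣ * (energy k h - mean k h * mean k h)
∣stab∣≤ s zero {h} {c} h-bdd c≤1 = ≤-reflexive (trans (∣^∣ (h []) (2 ℕ.+ s))
  (solve 3 (λ p c h → p := p :+ c :* (h :* (h :* con 1ℚ) :- h :* h)) refl (∣ h [] ∣ ^ (2 ℕ.+ s)) ∣ c ∣ (h [])))
∣stab∣≤ s (suc k) {h} {c} h-bdd c≤1 = ≤-trans
  (≤-trans (∣p+q∣≤∣p∣+∣q∣ (stab r k (h ⁺) c) (c * stab r k (h ⁻) c))
    (+-mono-≤ (∣stab∣≤ s k (⁺-bounded {h = h} h-bdd) c≤1)
      (subst (_≤ ∣ c ∣ * bound⁻) (sym (∣p*q∣≡∣p∣*∣q∣ c (stab r k (h ⁻) c)))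
        (*-monoˡ-≤-nonNeg ∣ c ∣ {{∣-∣-nonNeg c}} (∣stab∣≤ s k (⁻-bounded {h = h} h-bdd) c≤1)))))
  (subst (λ M → ∣ m ∣ ^ r + ∣ c ∣ * (energy k (h ⁺) - m * m) + ∣ c ∣ * bound⁻ ≤
                ∣ M ∣ ^ r + ∣ c ∣ * (energy (suc k) h - M * M)) (sym (mean-suc k h))
    (≤-from
      (0≤* (0≤∣p∣ c) (0≤+ (0≤- power≤) (0≤* (0≤- c≤1) (0≤- (mean²≤energy k (h ⁻))))))
      (solve 7 (λ c P m V⁺ q V⁻ m′² →
          P :+ c :* ((V⁺ :+ con 1ℚ :* V⁻) :- m :* m) :=
          (P :+ c :* (V⁺ :- m :* m)) :+ c :* (q :+ c :* (V⁻ :- m′²)) :+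
          c :* ((m′² :- q) :+ (con 1ℚ :- c) :* (V⁻ :- m′²)))
        refl ∣ c ∣ (∣ m ∣ ^ r) m (energy k (h ⁺)) (∣ m′ ∣ ^ r) (energy k (h ⁻)) (m′ * m′))))
  where
  r = 2 ℕ.+ s
  m = mean k (h ⁺)
  m′ = mean k (h ⁻)
  bound⁻ = ∣ m′ ∣ ^ r + ∣ c ∣ * (energy k (h ⁻) - m′ * m′)
  ∣m′∣≤1 : ∣ m′ ∣ ≤ 1ℚ
  ∣m′∣≤1 = ∣mean∣≤1 k (⁻-bounded {h = h} h-bdd)
  power≤ : ∣ m′ ∣ ^ r ≤ m′ * m′
  power≤ = subst (∣ m′ ∣ ^ r ≤_) (∣p∣² m′)
    (≤-from (0≤* (0≤* (0≤∣p∣ m′) (0≤∣p∣ m′)) (0≤- (^≤1 s (0≤∣p∣ m′) ∣m′∣≤1)))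
      (solve 2 (λ m q → m :* m := m :* (m :* q) :+ m :* m :* (con 1ℚ :- q)) refl ∣ m′ ∣ (∣ m′ ∣ ^ s)))

-- Monotone connectives

χ∘-bounded : ∀ {k} (α : Connective k) → Bounded (χ ∘ α)
χ∘-bounded α x = ≤-reflexive (∣χ∣ (α x))

restrict-monotone : ∀ {k} {α : Connective (suc k)} b → Monotone α → Monotone (α ∘ (b ∷_))
restrict-monotone b α-mono a≤b = α-mono (Bool.≤-refl ∷ a≤b)

false≤true : ∀ {k} {α : Connective (suc k)} → Monotone α → ∀ x → α (false ∷ x) Bool.≤ α (true ∷ x)
false≤true α-mono x = α-mono (f≤t ∷ Pointwise.refl Bool.≤-refl)

-- The value of (χ ∘ α) ⁻ when b and c are the values of α at the two settings of
-- its first argument. On comparable values it is 0 or 1.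
gap : Bool → Bool → ℚ
gap b c = ½ * (χ c - χ b)

gap-idem : ∀ {b c} → b Bool.≤ c → gap b c * gap b c ≡ gap b c
gap-idem f≤t           = refl
gap-idem (b≤b {true})  = refl
gap-idem (b≤b {false}) = refl

0≤gap : ∀ {b c} → b Bool.≤ c → 0ℚ ≤ gap b c
0≤gap f≤t           = 0≤1
0≤gap (b≤b {true})  = ≤-refl
0≤gap (b≤b {false}) = ≤-refl

gap≡0 : ∀ {b c} → b Bool.≤ c → gap b c ≡ 0ℚ → b ≡ c
gap≡0 f≤t ()
gap≡0 b≤b _ = refl

-- For monotone α, the probability that the first argument decides the value of α
-- when the other arguments are uniform random bits.
influence : ∀ {k} → Connective (suc k) → ℚ
influence {k} α = mean k ((χ ∘ α) ⁻)

0≤influence : ∀ {k} {α : Connective (suc k)} → Monotone α → 0ℚ ≤ influence α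
0≤influence {k} α-mono = mean-0≤ k (λ x → 0≤gap (false≤true α-mono x))

influence≤1 : ∀ {k} (α : Connective (suc k)) → influence α ≤ 1ℚ
influence≤1 {k} α = ≤-trans (p≤∣p∣ (influence α))
  (∣mean∣≤1 k (⁻-bounded {h = χ ∘ α} (χ∘-bounded α)))

-- Amplification of a bias

-- With F(y) the multilinear extension of χ ∘ β and m its mean, a nonnegative
-- margin says that F(y) lies beyond (m + y) / (1 + m y), away from m, on the
-- side of the sign of y. Integrating the Poincaré inequality
-- F'(y) (1 - y²) ≥ 1 - F(y)² gives the same bound; the proof below is an
-- induction on the number of arguments instead.
margin : ∀ {k} → Connective k → ℚ → ℚ
margin {k} β y = y * (ext k (χ ∘ β) y * (1ℚ + mean k (χ ∘ β) * y) - (mean k (χ ∘ β) + y))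

0<1+*y : ∀ {m y} → ∣ m ∣ ≤ 1ℚ → ∣ y ∣ < 1ℚ → 0ℚ < 1ℚ + m * y
0<1+*y {m} {y} m≤1 y<1 = <-from (0<- (≤-<-trans
    (≤-trans (-p≤∣p∣ (m * y)) (subst (_≤ ∣ y ∣) (cong ∣_∣ (*-comm y m)) (∣*∣≤∣∣ y m≤1))) y<1))
  (solve 1 (λ p → con 1ℚ :+ p := con 0ℚ :+ (con 1ℚ :- (:- p))) refl (m * y))

0<1-y² : ∀ {y} → ∣ y ∣ < 1ℚ → 0ℚ < 1ℚ - y * y
0<1-y² {y} y<1 = subst (0ℚ <_) (solve 1 (λ y → con 1ℚ :+ (:- y) :* y := con 1ℚ :- y :* y) refl y)
  (0<1+*y (subst (_≤ 1ℚ) (sym (∣-p∣≡∣p∣ y)) (<⇒≤ y<1)) y<1)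

-- The induction step, splitting β on its first argument.
module MarginStep {k} {β : Connective (suc k)} (β-mono : Monotone β) {y} (y<1 : ∣ y ∣ < 1ℚ) where
  β₀ β₁ : Connective k
  β₀ = β ∘ (false ∷_)
  β₁ = β ∘ (true ∷_)
  F₀ F₁ m₀ m₁ d₀ d₁ gain : ℚ
  F₀ = ext k (χ ∘ β₀) y
  F₁ = ext k (χ ∘ β₁) y
  m₀ = mean k (χ ∘ β₀)
  m₁ = mean k (χ ∘ β₁)
  d₀ = 1ℚ + m₀ * y
  d₁ = 1ℚ + m₁ * y
  gain = ½ * (y * y * (1ℚ - y * y) * ((m₁ - m₀) * ((1ℚ - y) * (1ℚ - m₁) + (1ℚ + y) * (1ℚ + m₀))))

  ∣m₀∣≤1 : ∣ m₀ ∣ ≤ 1ℚ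
  ∣m₀∣≤1 = ∣mean∣≤1 k (χ∘-bounded β₀)
  ∣m₁∣≤1 : ∣ m₁ ∣ ≤ 1ℚ
  ∣m₁∣≤1 = ∣mean∣≤1 k (χ∘-bounded β₁)
  0<d₀ : 0ℚ < d₀
  0<d₀ = 0<1+*y ∣m₀∣≤1 y<1
  0<d₁ : 0ℚ < d₁
  0<d₁ = 0<1+*y ∣m₁∣≤1 y<1
  0≤1-y : 0ℚ ≤ 1ℚ - y
  0≤1-y = 0≤1-∣∣ (<⇒≤ y<1)
  0≤1+y : 0ℚ ≤ 1ℚ + y
  0≤1+y = 0≤1+∣∣ (<⇒≤ y<1)

  -- The margins of the two restrictions enter with nonnegative weights; what is
  -- left over is the gain, which for y ≠ 0 is positive when β depends on its first
  -- argument without being equal to it.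
  gain≤ : 0ℚ ≤ margin β₀ y → 0ℚ ≤ margin β₁ y → gain ≤ (1ℚ + 1ℚ) * (d₀ * d₁ * margin β y)
  gain≤ 0≤X₀ 0≤X₁ = ≤-from
    (0≤* 0≤½ (0≤* (0≤+ (<⇒≤ 0<d₀) (<⇒≤ 0<d₁))
      (0≤+ (0≤* (0≤* 0≤1-y (<⇒≤ 0<d₁)) 0≤X₀) (0≤* (0≤* 0≤1+y (<⇒≤ 0<d₀)) 0≤X₁))))
    (solve 5 (λ y F₀ F₁ m₀ m₁ →
        let d₀ = con 1ℚ :+ m₀ :* y
            d₁ = con 1ℚ :+ m₁ :* y
            F = con ½ :* ((con 1ℚ :- y) :* F₀ :+ (con 1ℚ :+ y) :* F₁)
            m = con ½ :* ((con 1ℚ :- con 0ℚ) :* m₀ :+ (con 1ℚ :+ con 0ℚ) :* m₁)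
        in con (1ℚ + 1ℚ) :* (d₀ :* d₁ :* (y :* (F :* (con 1ℚ :+ m :* y) :- (m :+ y)))) :=
           con ½ :* (y :* y :* (con 1ℚ :- y :* y) :*
             ((m₁ :- m₀) :* ((con 1ℚ :- y) :* (con 1ℚ :- m₁) :+ (con 1ℚ :+ y) :* (con 1ℚ :+ m₀)))) :+
           con ½ :* ((d₀ :+ d₁) :*
             ((con 1ℚ :- y) :* d₁ :* (y :* (F₀ :* d₀ :- (m₀ :+ y))) :+
              (con 1ℚ :+ y) :* d₀ :* (y :* (F₁ :* d₁ :- (m₁ :+ y))))))
      refl y F₀ F₁ m₀ m₁)

  m₁-m₀ : m₁ - m₀ ≡ (1ℚ + 1ℚ) * influence β
  m₁-m₀ = trans (solve 2 (λ p q → q :- p := con (1ℚ + 1ℚ) :* (con ½ :* (q :- p))) refl m₀ m₁)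
                (cong ((1ℚ + 1ℚ) *_) (sym (ext-⁻ k (χ ∘ β) 0ℚ)))

  0≤gain : 0ℚ ≤ gain
  0≤gain = 0≤* 0≤½ (0≤* (0≤* (0≤p² y) (<⇒≤ (0<1-y² y<1))) (0≤*
    (subst (0ℚ ≤_) (sym m₁-m₀) (0≤* (<⇒≤ (+-mono-< 0<1 0<1)) (0≤influence β-mono)))
    (0≤+ (0≤* 0≤1-y (0≤1-∣∣ ∣m₁∣≤1)) (0≤* 0≤1+y (0≤1+∣∣ ∣m₀∣≤1)))))

0≤margin : ∀ {k} {β : Connective k} → Monotone β → ∀ {y} → ∣ y ∣ < 1ℚ → 0ℚ ≤ margin β y
0≤margin {zero} {β} β-mono {y} y<1 = ≤-reflexive (sym (trans
  (solve 2 (λ x y → y :* (x :* (con 1ℚ :+ x :* y) :- (x :+ y)) := y :* y :* (x :* x :- con 1ℚ)) refl (χ (β [])) y)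
  (trans (cong (λ z → y * y * (z - 1ℚ)) (χ² (β []))) (*-zeroʳ (y * y)))))
0≤margin {suc k} {β} β-mono {y} y<1 = *-cancelˡ-≤-pos ((1ℚ + 1ℚ) * (d₀ * d₁))
  {{positive (0<* (+-mono-< 0<1 0<1) (0<* 0<d₀ 0<d₁))}}
  (subst₂ _≤_ (sym (*-zeroʳ ((1ℚ + 1ℚ) * (d₀ * d₁)))) (sym (*-assoc (1ℚ + 1ℚ) (d₀ * d₁) (margin β y)))
    (≤-trans 0≤gain (gain≤ (0≤margin (restrict-monotone {α = β} false β-mono) y<1)
                           (0≤margin (restrict-monotone {α = β} true β-mono) y<1))))
  where open MarginStep β-mono y<1

-- Pivotal arguments and contraction

-- A connective β with the same Fourier weights as α whose first argument is
-- neither irrelevant nor decisive on its own. It arises from α by discarding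
-- leading arguments on which α does not depend.
record Pivotal {k} (α : Connective k) : Set where
  field
    {k′}       : ℕ
    β          : Connective (suc k′)
    β-monotone : Monotone β
    β-mean     : mean (suc k′) (χ ∘ β) ≡ 0ℚ
    0<m        : 0ℚ < influence β
    m<1        : influence β < 1ℚ
    stab≡      : ∀ r c → stab (suc r) k (χ ∘ α) c ≡ stab (suc r) (suc k′) (χ ∘ β) c

χ≢0 : ∀ b → χ b ≢ 0ℚ
χ≢0 true  ()
χ≢0 false ()

1-χ≡0 : ∀ b → 1ℚ - χ b ≡ 0ℚ → b ≡ true
1-χ≡0 true  _ = refl
1-χ≡0 false ()

1+χ≡0 : ∀ b → 1ℚ + χ b ≡ 0ℚ → b ≡ false
1+χ≡0 true  ()
1+χ≡0 false _ = refl

-- An influence of 0 makes the first argument irrelevant, and an influence of 1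
-- makes α the projection to it.
pivotal : ∀ {k} {α : Connective k} → Monotone α → mean k (χ ∘ α) ≡ 0ℚ → ¬ IsProjection α → Pivotal α
pivotal {zero} {α} _ mean≡ _ = contradiction mean≡ (χ≢0 (α []))
pivotal {suc k} {α} α-mono mean≡ ¬proj with <-cmp 0ℚ (influence α) | <-cmp (influence α) 1ℚ
... | tri> _ _ m<0 | _ = contradiction (<-≤-trans m<0 (0≤influence α-mono)) (<-irrefl refl)
... | tri< _ _ _ | tri> _ _ 1<m = contradiction (<-≤-trans 1<m (influence≤1 α)) (<-irrefl refl)
... | tri< 0<m _ _ | tri< m<1 _ _ = record
  { β = α ; β-monotone = α-mono ; β-mean = mean≡ ; 0<m = 0<m ; m<1 = m<1 ; stab≡ = λ _ _ → refl }
... | tri< _ _ _ | tri≈ _ m≡1 _ = contradiction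
  (zero , λ { (true ∷ x) → 1-χ≡0 (α₁ x) (mean≡0 k (λ x → 0≤1-∣∣ (χ∘-bounded α₁ x)) 1-m₁ x)
                ; (false ∷ x) → 1+χ≡0 (α₀ x) (mean≡0 k (λ x → 0≤1+∣∣ (χ∘-bounded α₀ x)) 1+m₀ x) })
  ¬proj
  where
  α₀ = α ∘ (false ∷_)
  α₁ = α ∘ (true ∷_)
  m₀ = mean k (χ ∘ α₀)
  m₁ = mean k (χ ∘ α₁)
  total≡ : ½ * (m₁ - m₀) ≡ 1ℚ
  total≡ = trans (sym (ext-⁻ k (χ ∘ α) 0ℚ)) m≡1
  1-m₁ : mean k (λ x → 1ℚ - χ (α₁ x)) ≡ 0ℚ
  1-m₁ = trans (ext-1- k (χ ∘ α₁) 0ℚ) (trans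
    (solve 2 (λ f t → con 1ℚ :- t := con 1ℚ :-
        (con ½ :* ((con 1ℚ :- con 0ℚ) :* f :+ (con 1ℚ :+ con 0ℚ) :* t) :+ con ½ :* (t :- f))) refl m₀ m₁)
    (cong₂ (λ p q → 1ℚ - (p + q)) mean≡ total≡))
  1+m₀ : mean k (λ x → 1ℚ + χ (α₀ x)) ≡ 0ℚ
  1+m₀ = trans (ext-1+ k (χ ∘ α₀) 0ℚ) (trans
    (solve 2 (λ f t → con 1ℚ :+ f := con 1ℚ :+
        (con ½ :* ((con 1ℚ :- con 0ℚ) :* f :+ (con 1ℚ :+ con 0ℚ) :* t) :- con ½ :* (t :- f))) refl m₀ m₁)
    (cong₂ (λ p q → 1ℚ + (p - q)) mean≡ total≡))
... | tri≈ _ 0≡m _ | _ = record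
  { Pivotal rec
  ; stab≡ = λ r c → trans
      (cong₂ (λ p q → p + c * q)
        (stab-cong (suc r) k c (λ x → trans (cong (λ b → ½ * (χ (α₁ x) + χ b)) (α₀≡α₁ x))
          (solve 1 (λ t → con ½ :* (t :+ t) := t) refl (χ (α₁ x)))))
        (trans (stab-cong (suc r) k c h⁻≡0) (stab-0 r k c)))
      (trans (solve 2 (λ p c → p :+ c :* con 0ℚ := p) refl (stab (suc r) k (χ ∘ α₁) c) c)
             (Pivotal.stab≡ rec r c))
  }
  where
  α₁ = α ∘ (true ∷_)
  h⁻≡0 : ∀ x → ((χ ∘ α) ⁻) x ≡ 0ℚ
  h⁻≡0 = mean≡0 k (λ x → 0≤gap (false≤true α-mono x)) (sym 0≡m)
  α₀≡α₁ : ∀ x → α (false ∷ x) ≡ α (true ∷ x)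
  α₀≡α₁ x = gap≡0 (false≤true α-mono x) (h⁻≡0 x)
  rec : Pivotal α₁
  rec = pivotal (restrict-monotone {α = α} true α-mono)
    (trans
      (solve 2 (λ f t → t := con ½ :* ((con 1ℚ :- con 0ℚ) :* f :+ (con 1ℚ :+ con 0ℚ) :* t) :+ con ½ :* (t :- f))
        refl (mean k (χ ∘ α ∘ (false ∷_))) (mean k (χ ∘ α₁)))
      (cong₂ _+_ mean≡ (sym (trans 0≡m (ext-⁻ k (χ ∘ α) 0ℚ)))))
    (λ { (i , e) → ¬proj (suc i , λ { (true ∷ x) → e x ; (false ∷ x) → trans (α₀≡α₁ x) (e x) }) })

-- The behaviour of stab r (χ ∘ α) as a map on correlations, for r = 1, 2 and r ≥ 3.
module Contraction {k} {α : Connective k} (p : Pivotal α) where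
  open Pivotal p

  private
    m = influence β
    h = χ ∘ β
    0≤m = <⇒≤ 0<m
    0<1-m = 0<- m<1

  δ : ℚ
  δ = m * (1ℚ - m)

  0<δ : 0ℚ < δ
  0<δ = 0<* 0<m 0<1-m

  δ≤1 : δ ≤ 1ℚ
  δ≤1 = ≤-from (0≤+ (<⇒≤ 0<1-m) (0≤p² m))
    (solve 1 (λ m → con 1ℚ := m :* (con 1ℚ :- m) :+ ((con 1ℚ :- m) :+ m :* m)) refl m)

  -- A single value: its bias is amplified.
  drift : ∀ {y} → ∣ y ∣ < 1ℚ → δ * (y * y * (1ℚ - y * y)) ≤ y * (stab 1 k (χ ∘ α) y - y)
  drift {y} y<1 = subst (λ F → δ * (y * y * (1ℚ - y * y)) ≤ y * (F - y))
    (trans (sym (stab₁≡ext (suc k′) h y)) (sym (stab≡ 0 y)))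
    (≤-from
      (0≤+ (0≤* 0≤½ (0≤- gain≤′)) (0≤* (0≤* (0≤p² m) (0≤p² y)) 0≤X))
      (solve 3 (λ m y X → X :=
          m :* (con 1ℚ :- m) :* (y :* y :* (con 1ℚ :- y :* y)) :+
          (con ½ :* (con (1ℚ + 1ℚ) :* ((con 1ℚ :+ (:- m) :* y) :* (con 1ℚ :+ m :* y) :* X) :-
             con ½ :* (y :* y :* (con 1ℚ :- y :* y) :* ((m :- :- m) :*
               ((con 1ℚ :- y) :* (con 1ℚ :- m) :+ (con 1ℚ :+ y) :* (con 1ℚ :+ :- m))))) :+
           m :* m :* (y :* y) :* X)) refl m y X))
    where
    open MarginStep β-monotone y<1
    F = ext (suc k′) h y
    X = y * (F - y)
    margin≡X : margin β y ≡ X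
    margin≡X = trans (cong (λ z → y * (F * (1ℚ + z * y) - (z + y))) β-mean)
      (solve 2 (λ y F → y :* (F :* (con 1ℚ :+ con 0ℚ :* y) :- (con 0ℚ :+ y)) := y :* (F :- y)) refl y F)
    0≤X : 0ℚ ≤ X
    0≤X = subst (0ℚ ≤_) margin≡X (0≤margin β-monotone y<1)
    m≡ : ½ * (m₁ - m₀) ≡ m
    m≡ = sym (ext-⁻ k′ h 0ℚ)
    m₁≡ : m₁ ≡ m
    m₁≡ = trans
      (solve 2 (λ f t → t := con ½ :* ((con 1ℚ :- con 0ℚ) :* f :+ (con 1ℚ :+ con 0ℚ) :* t) :+ con ½ :* (t :- f)) refl m₀ m₁)
      (trans (cong₂ _+_ β-mean m≡) (+-identityˡ m))
    m₀≡ : m₀ ≡ - m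
    m₀≡ = trans
      (solve 2 (λ f t → f := con ½ :* ((con 1ℚ :- con 0ℚ) :* f :+ (con 1ℚ :+ con 0ℚ) :* t) :- con ½ :* (t :- f)) refl m₀ m₁)
      (trans (cong₂ _-_ β-mean m≡) (+-identityˡ (- m)))
    gain≤′ : ½ * (y * y * (1ℚ - y * y) * ((m - - m) * ((1ℚ - y) * (1ℚ - m) + (1ℚ + y) * (1ℚ + - m)))) ≤
             (1ℚ + 1ℚ) * ((1ℚ + (- m) * y) * (1ℚ + m * y) * X)
    gain≤′ = subst (λ X → ½ * (y * y * (1ℚ - y * y) * ((m - - m) * ((1ℚ - y) * (1ℚ - m) + (1ℚ + y) * (1ℚ + - m)))) ≤
                          (1ℚ + 1ℚ) * ((1ℚ + (- m) * y) * (1ℚ + m * y) * X)) margin≡X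
      (subst₂ (λ m₀ m₁ →
          ½ * (y * y * (1ℚ - y * y) * ((m₁ - m₀) * ((1ℚ - y) * (1ℚ - m₁) + (1ℚ + y) * (1ℚ + m₀)))) ≤
          (1ℚ + 1ℚ) * ((1ℚ + m₀ * y) * (1ℚ + m₁ * y) * margin β y)) m₀≡ m₁≡
        (gain≤ (0≤margin (restrict-monotone {α = β} false β-monotone) y<1)
               (0≤margin (restrict-monotone {α = β} true β-monotone) y<1)))

  -- Harnack's inequality for 1 - χ ∘ β and 1 + χ ∘ β, both of mean 1.
  stab₁-interior : ∀ {y} → ∣ y ∣ < 1ℚ → ∣ stab 1 k (χ ∘ α) y ∣ < 1ℚ
  stab₁-interior {y} y<1 = subst (λ F → ∣ F ∣ < 1ℚ)
    (trans (sym (stab₁≡ext (suc k′) h y)) (sym (stab≡ 0 y)))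
    (∣∣< (<-from (strict (ext-1- (suc k′) h y) (λ x → 0≤1-∣∣ (χ∘-bounded β x))
                   (trans (ext-1- (suc k′) h 0ℚ) (cong (λ z → 1ℚ - z) β-mean)))
           (solve 1 (λ F → con 1ℚ := F :+ (con 1ℚ :- F)) refl F))
         (<-from (strict (ext-1+ (suc k′) h y) (λ x → 0≤1+∣∣ (χ∘-bounded β x))
                   (trans (ext-1+ (suc k′) h 0ℚ) (cong (1ℚ +_) β-mean)))
           (solve 1 (λ F → con 1ℚ := :- F :+ (con 1ℚ :+ F)) refl F)))
    where
    F = ext (suc k′) h y
    z = 1ℚ - ∣ y ∣
    0<z : 0ℚ < z
    0<z = 0<- y<1
    strict : ∀ {g : RealFun (suc k′)} {G} → ext (suc k′) g y ≡ G → (∀ x → 0ℚ ≤ g x) → mean (suc k′) g ≡ 1ℚ → 0ℚ < G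
    strict {g} refl 0≤g mean≡1 = <-≤-trans (0<^ (suc k′) 0<z)
      (subst (_≤ ext (suc k′) g y) (trans (cong (z ^ suc k′ *_) mean≡1) (*-identityʳ (z ^ suc k′)))
        (ext-harnack (suc k′) {y = y} (<⇒≤ 0<z)
          (≤-from (0≤- (p≤∣p∣ y)) (solve 2 (λ y a → con 1ℚ :- y := con 1ℚ :- a :+ (a :- y)) refl y ∣ y ∣))
          (≤-from (0≤- (-p≤∣p∣ y)) (solve 2 (λ y a → con 1ℚ :+ y := con 1ℚ :- a :+ (a :- :- y)) refl y ∣ y ∣))
          0≤g))

  -- The bound splits on the first argument: χ ∘ β has total energy 1, of which
  -- (χ ∘ β) ⁻, being idempotent, carries an amount equal to its mean m.
  stab-bound : ∀ s {c} → ∣ c ∣ ≤ 1ℚ →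
    ∣ stab (2 ℕ.+ s) k (χ ∘ α) c ∣ ≤ ∣ c ∣ * (1ℚ - m + m ^ (2 ℕ.+ s) + ∣ c ∣ * (m - m * m))
  stab-bound s {c} c≤1 = subst (λ z → ∣ z ∣ ≤ ∣ c ∣ * (1ℚ - m + m ^ r + ∣ c ∣ * (m - m * m))) (sym (stab≡ (suc s) c))
    (≤-trans (≤-trans (∣p+q∣≤∣p∣+∣q∣ (stab r k′ (h ⁺) c) (c * stab r k′ (h ⁻) c))
      (+-mono-≤ (∣stab∣≤ s k′ (⁺-bounded {h = h} (χ∘-bounded β)) c≤1)
        (subst (_≤ ∣ c ∣ * bound⁻) (sym (∣p*q∣≡∣p∣*∣q∣ c (stab r k′ (h ⁻) c)))
          (*-monoˡ-≤-nonNeg ∣ c ∣ {{∣-∣-nonNeg c}} (∣stab∣≤ s k′ (⁻-bounded {h = h} (χ∘-bounded β)) c≤1)))))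
      (≤-reflexive (trans
        (cong₂ (λ M V → ∣ M ∣ ^ r + ∣ c ∣ * (V - M * M) + ∣ c ∣ * bound⁻) mean⁺≡0 energy⁺)
        (trans (cong₂ (λ a V → ∣ 0ℚ ∣ ^ r + ∣ c ∣ * (1ℚ - m - 0ℚ * 0ℚ) + ∣ c ∣ * (a ^ r + ∣ c ∣ * (V - m * m)))
                      (0≤p⇒∣p∣≡p 0≤m) energy⁻)
          (solve 4 (λ c m q z → con 0ℚ :* z :+ c :* (con 1ℚ :- m :- con 0ℚ :* con 0ℚ) :+ c :* (q :+ c :* (m :- m :* m)) :=
                                c :* (con 1ℚ :- m :+ q :+ c :* (m :- m :* m))) refl ∣ c ∣ m (m ^ r) (0ℚ ^ suc s))))))
    where
    r = 2 ℕ.+ s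
    bound⁻ = ∣ m ∣ ^ r + ∣ c ∣ * (energy k′ (h ⁻) - m * m)
    mean⁺≡0 : mean k′ (h ⁺) ≡ 0ℚ
    mean⁺≡0 = trans (sym (mean-suc k′ h)) β-mean
    energy⁻ : energy k′ (h ⁻) ≡ m
    energy⁻ = trans (parseval k′ (h ⁻)) (ext-cong k′ 0ℚ (λ x → gap-idem (false≤true β-monotone x)))
    energy≡1 : energy (suc k′) h ≡ 1ℚ
    energy≡1 = trans (parseval (suc k′) h)
      (trans (ext-cong (suc k′) 0ℚ (λ x → χ² (β x))) (ext-const (suc k′) 1ℚ 0ℚ))
    energy⁺ : energy k′ (h ⁺) ≡ 1ℚ - m
    energy⁺ = trans (solve 2 (λ p q → p := (p :+ con 1ℚ :* q) :- q) refl (energy k′ (h ⁺)) (energy k′ (h ⁻)))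
                    (cong₂ _-_ energy≡1 energy⁻)

  -- Two values: a correlation bounded away from 1 and -1 is contracted.
  contract₂ : ∀ {c} → ∣ c ∣ ≤ 1ℚ → ∣ stab 2 k (χ ∘ α) c ∣ ≤ ∣ c ∣ * (1ℚ - δ * (1ℚ - ∣ c ∣))
  contract₂ {c} c≤1 = subst (∣ stab 2 k (χ ∘ α) c ∣ ≤_)
    (solve 2 (λ c m → c :* (con 1ℚ :- m :+ m :* (m :* con 1ℚ) :+ c :* (m :- m :* m)) :=
                      c :* (con 1ℚ :- (m :* (con 1ℚ :- m)) :* (con 1ℚ :- c))) refl ∣ c ∣ m)
    (stab-bound 0 c≤1)

  -- Three or more values: every correlation is contracted, since Fourier
  -- coefficients other than 0 and ±1 shrink when raised to a power above 2.
  contract₃ : ∀ s {c} → ∣ c ∣ ≤ 1ℚ → ∣ stab (3 ℕ.+ s) k (χ ∘ α) c ∣ ≤ (1ℚ - m * δ) * ∣ c ∣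
  contract₃ s {c} c≤1 = ≤-trans (stab-bound (suc s) c≤1)
    (≤-from (0≤* (0≤∣p∣ c) (0≤+ (0≤* (0≤* (0≤* 0≤m 0≤m) 0≤m) (0≤- (^≤1 s 0≤m (<⇒≤ m<1))))
                                (0≤* (0≤- c≤1) (<⇒≤ 0<δ))))
      (solve 3 (λ c m q → (con 1ℚ :- m :* (m :* (con 1ℚ :- m))) :* c :=
          c :* (con 1ℚ :- m :+ m :* (m :* (m :* q)) :+ c :* (m :- m :* m)) :+
          c :* (m :* m :* m :* (con 1ℚ :- q) :+ (con 1ℚ :- c) :* (m :* (con 1ℚ :- m))))
        refl ∣ c ∣ m (m ^ s)))

  0<mδ : 0ℚ < m * δ
  0<mδ = 0<* 0<m 0<δ

  mδ≤1 : m * δ ≤ 1ℚ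
  mδ≤1 = ≤-from (0≤+ (0≤- (<⇒≤ m<1)) (0≤* 0≤m (0≤- δ≤1)))
    (solve 2 (λ m d → con 1ℚ := m :* d :+ ((con 1ℚ :- m) :+ m :* (con 1ℚ :- d))) refl m δ)

-- Balanced connectives have mean zero

∑-assignments : ∀ k (h : RealFun k) → ∑ (assignments k) h ≡ (1ℚ + 1ℚ) ^ k * mean k h
∑-assignments zero    h = solve 1 (λ h → h :+ con 0ℚ := con 1ℚ :* h) refl (h [])
∑-assignments (suc k) h = trans
  (∑-cartesianProductWith _∷_ (false ∷ true ∷ []) (assignments k) h)
  (trans (cong₂ (λ p q → p + (q + 0ℚ)) (∑-assignments k (h ∘ (false ∷_))) (∑-assignments k (h ∘ (true ∷_))))
    (solve 3 (λ w f t → w :* f :+ (w :* t :+ con 0ℚ) :=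
        con (1ℚ + 1ℚ) :* w :* (con ½ :* ((con 1ℚ :- con 0ℚ) :* f :+ (con 1ℚ :+ con 0ℚ) :* t)))
      refl ((1ℚ + 1ℚ) ^ k) (mean k (h ∘ (false ∷_))) (mean k (h ∘ (true ∷_)))))

⟦2^⟧ : ∀ k → ⟦ 2 ℕ.^ k ⟧ ≡ (1ℚ + 1ℚ) ^ k
⟦2^⟧ zero    = refl
⟦2^⟧ (suc k) = trans (⟦⟧-homo-+ (2 ℕ.^ k) (2 ℕ.^ k ℕ.+ 0)) (trans
  (cong (⟦ 2 ℕ.^ k ⟧ +_) (cong ⟦_⟧ (ℕ.+-identityʳ (2 ℕ.^ k))))
  (trans (cong (λ z → z + z) (⟦2^⟧ k))
    (solve 1 (λ z → z :+ z := con (1ℚ + 1ℚ) :* z) refl ((1ℚ + 1ℚ) ^ k))))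

∑χ : ∀ {k} (α : Connective k) L →
     ∑ L (χ ∘ α) + ∑ L (const 1ℚ) ≡
     ⟦ length (filter (λ a → α a Bool.≟ true) L) ⟧ + ⟦ length (filter (λ a → α a Bool.≟ true) L) ⟧
∑χ α []      = refl
∑χ α (a ∷ L) with α a | ∑χ α L
... | true  | rec = trans
  (solve 2 (λ p q → con 1ℚ :+ p :+ (con 1ℚ :+ q) := con (1ℚ + 1ℚ) :+ (p :+ q)) refl (∑ L (χ ∘ α)) (∑ L (const 1ℚ)))
  (trans (cong ((1ℚ + 1ℚ) +_) rec)
    (solve 1 (λ c → con (1ℚ + 1ℚ) :+ (c :+ c) := con 1ℚ :+ c :+ (con 1ℚ :+ c)) refl
      ⟦ length (filter (λ a → α a Bool.≟ true) L) ⟧))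
... | false | rec = trans
  (solve 2 (λ p q → con (- 1ℚ) :+ p :+ (con 1ℚ :+ q) := p :+ q) refl (∑ L (χ ∘ α)) (∑ L (const 1ℚ))) rec

balanced⇒mean≡0 : ∀ {k} {α : Connective k} → Balanced α → mean k (χ ∘ α) ≡ 0ℚ
balanced⇒mean≡0 {k} {α} bal = *-cancelˡ-zero
  where
  w = (1ℚ + 1ℚ) ^ k
  c = length (filter (λ a → α a Bool.≟ true) (assignments k))
  0<w : 0ℚ < w
  0<w = 0<^ k (+-mono-< 0<1 0<1)
  counts : w * mean k (χ ∘ α) + w * 1ℚ ≡ w
  counts = begin
    w * mean k (χ ∘ α) + w * 1ℚ
      ≡⟨ cong (λ q → w * mean k (χ ∘ α) + w * q) (ext-const k 1ℚ 0ℚ) ⟨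
    w * mean k (χ ∘ α) + w * mean k (const 1ℚ)
      ≡⟨ cong₂ _+_ (∑-assignments k (χ ∘ α)) (∑-assignments k (const 1ℚ)) ⟨
    ∑ (assignments k) (χ ∘ α) + ∑ (assignments k) (const 1ℚ)
      ≡⟨ ∑χ α (assignments k) ⟩
    ⟦ c ⟧ + ⟦ c ⟧
      ≡⟨ ⟦⟧-homo-+ c c ⟨
    ⟦ c ℕ.+ c ⟧
      ≡⟨ cong ⟦_⟧ (cong (c ℕ.+_) (sym (ℕ.+-identityʳ c))) ⟩
    ⟦ 2 ℕ.* c ⟧
      ≡⟨ cong ⟦_⟧ bal ⟩
    ⟦ 2 ℕ.^ k ⟧
      ≡⟨ ⟦2^⟧ k ⟩
    w ∎
    where open ≡-Reasoning
  w*mean≡0 : w * mean k (χ ∘ α) ≡ w * 0ℚ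
  w*mean≡0 = trans (solve 2 (λ w m → w :* m := (w :* m :+ w :* con 1ℚ) :- w) refl w (mean k (χ ∘ α)))
    (trans (cong (_- w) counts) (trans (+-inverseʳ w) (sym (*-zeroʳ w))))
  *-cancelˡ-zero : mean k (χ ∘ α) ≡ 0ℚ
  *-cancelˡ-zero = ≤-antisym
    (*-cancelˡ-≤-pos w {{positive 0<w}} (≤-reflexive w*mean≡0))
    (*-cancelˡ-≤-pos w {{positive 0<w}} (≤-reflexive (sym w*mean≡0)))

-- The initial distribution

projection : ∀ {n} → Fin n → BoolFun n
projection i a = lookup a i

projection-injective : ∀ {n} {i j : Fin n} → projection i ≗ projection j → i ≡ j
projection-injective {n} {i} {j} e with j Fin.≟ i
... | yes j≡i = sym j≡i
... | no  j≢i = contradiction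
  (trans (sym (lookup∘update i zeros true)) (trans (e (zeros [ i ]≔ true))
    (trans (lookup∘update′ j≢i zeros true) (lookup-replicate j false))))
  λ ()
  where zeros = replicate n false

-- The functions in the support of the initial distribution, each listed once.
initials : ∀ n → List (BoolFun n)
initials n = const false ∷ const true ∷ List.tabulate projection

initials-unique : ∀ n → UniqueSetoid.Unique (BoolFunSetoid n) (initials n)
initials-unique n =
  ((λ e → contradiction (e (replicate n true)) λ ()) ∷
    All.tabulate⁺ (λ i e → contradiction (trans (e (replicate n true)) (lookup-replicate i true)) λ ())) ∷
  All.tabulate⁺ (λ i e → contradiction (trans (e (replicate n false)) (lookup-replicate i false)) λ ()) ∷
  UniqueSetoid.tabulate⁺ (BoolFunSetoid n) projection-injective

module _ {n} {f : BoolFun n} where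

  ∑-indicator-∉ : ∀ {L} → ¬ Any (f ≗_) L → ∑ L (λ g → indicator (g ≗? f)) ≡ 0ℚ
  ∑-indicator-∉ {[]}    f∉ = refl
  ∑-indicator-∉ {g ∷ L} f∉ = cong₂ _+_
    (indicator-no (g ≗? f) (λ e → f∉ (here (sym ∘ e)))) (∑-indicator-∉ (f∉ ∘ there))

  ∑-indicator-∈ : ∀ {L} → UniqueSetoid.Unique (BoolFunSetoid n) L → Any (f ≗_) L →
                  ∑ L (λ g → indicator (g ≗? f)) ≡ 1ℚ
  ∑-indicator-∈ {g ∷ L} (g∉ ∷ L!) (here f≗g) = cong₂ _+_
    (indicator-yes (g ≗? f) (sym ∘ f≗g))
    (∑-indicator-∉ (λ f∈ → All.All¬⇒¬Any g∉ (Any.map (≗-trans (sym ∘ f≗g)) f∈)))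
  ∑-indicator-∈ {g ∷ L} (g∉ ∷ L!) (there f∈) = cong₂ _+_
    (indicator-no (g ≗? f) (λ g≗f → All.All¬⇒¬Any g∉ (Any.map (≗-trans g≗f) f∈)))
    (∑-indicator-∈ L! f∈)

sum-tabulate-χ : ∀ {m} (a : Vec Bool m) →
  sum (List.tabulate (λ i → χ (lookup a i) * 1ℚ)) ≡ ⟦ weight a ⟧ + ⟦ weight a ⟧ - ⟦ m ⟧
sum-tabulate-χ [] = refl
sum-tabulate-χ {suc m} (true ∷ a) = trans (cong (1ℚ * 1ℚ +_) (sum-tabulate-χ a))
  (solve 2 (λ w m → con 1ℚ :* con 1ℚ :+ (w :+ w :- m) := con 1ℚ :+ w :+ (con 1ℚ :+ w) :- (con 1ℚ :+ m)) refl
    ⟦ weight a ⟧ ⟦ m ⟧)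
sum-tabulate-χ {suc m} (false ∷ a) = trans (cong (- 1ℚ * 1ℚ +_) (sum-tabulate-χ a))
  (solve 2 (λ w m → con (- 1ℚ) :* con 1ℚ :+ (w :+ w :- m) := w :+ w :- (con 1ℚ :+ m)) refl
    ⟦ weight a ⟧ ⟦ m ⟧)

sum-tabulate-1 : ∀ m → sum (List.tabulate {n = m} (const 1ℚ)) ≡ ⟦ m ⟧
sum-tabulate-1 zero    = refl
sum-tabulate-1 (suc m) = cong (1ℚ +_) (sum-tabulate-1 m)

differ : ∀ {n} {a b : Assignment n} → a ≢ b → ∃ λ i → lookup a i ≢ lookup b i
differ {a = []}    {[]}    a≢b = contradiction refl a≢b
differ {a = x ∷ a} {y ∷ b} a≢b with x Bool.≟ y
... | no  x≢y  = zero , x≢y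
... | yes refl = let i , e = differ (λ a≡b → a≢b (cong (x ∷_) a≡b)) in suc i , e

χχ≢ : ∀ {b c} → b ≢ c → χ b * (χ c * 1ℚ) ≡ - 1ℚ
χχ≢ {true}  {true}  b≢c = contradiction refl b≢c
χχ≢ {true}  {false} _   = refl
χχ≢ {false} {true}  _   = refl
χχ≢ {false} {false} b≢c = contradiction refl b≢c

-- Consequences of μ being uniform on the projections and constants.
module Initial {n} {μ : Mass n} (μ-uniform : IsUniformOn (λ f → IsProjection f ⊎ IsConstant f) μ) where

  open IsUniformOn μ-uniform
  open IsDistribution isDistribution using () renaming (resp to μ-resp; nonNegative to 0≤μ)

  -- The common mass of the functions in the support.
  v : ℚ
  v = μ (const false)

  0<v : 0ℚ < v
  0<v = Equivalence.from (support (const false)) (inj₂ (false , λ _ → refl))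

  ∈initials : ∀ {f} → IsProjection f ⊎ IsConstant f → Any (f ≗_) (initials n)
  ∈initials (inj₁ (i , e))     = there (there (Any.tabulate⁺ i e))
  ∈initials (inj₂ (false , e)) = here e
  ∈initials (inj₂ (true , e))  = there (here e)

  μ≡v : ∀ {f} → Any (f ≗_) (initials n) → μ f ≡ v
  μ≡v {f} f∈ = lookup-All (initials n)
      (refl ∷ uniform (inj₂ (true , λ _ → refl)) false∈ ∷
       All.tabulate⁺ (λ i → uniform (inj₁ (i , λ _ → refl)) false∈)) f∈
    where
    false∈ : IsProjection {n} (const false) ⊎ IsConstant {n} (const false)
    false∈ = inj₂ (false , λ _ → refl)
    lookup-All : ∀ L → All (λ g → μ g ≡ v) L → Any (f ≗_) L → μ f ≡ v
    lookup-All _ (e ∷ _)  (here f≗g) = trans (μ-resp f≗g) e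
    lookup-All _ (_ ∷ es) (there f∈) = lookup-All _ es f∈

  μ≡ : ∀ f → μ f ≡ v * ∑ (initials n) (λ g → indicator (g ≗? f))
  μ≡ f with Any.any? (f ≗?_) (initials n)
  ... | yes f∈ = trans (μ≡v f∈) (sym (trans (cong (v *_) (∑-indicator-∈ (initials-unique n) f∈)) (*-identityʳ v)))
  ... | no  f∉ = trans μf≡0 (sym (trans (cong (v *_) (∑-indicator-∉ f∉)) (*-zeroʳ v)))
    where
    μf≡0 : μ f ≡ 0ℚ
    μf≡0 with <-cmp 0ℚ (μ f)
    ... | tri< 0<μf _ _ = contradiction (∈initials (Equivalence.to (support f) 0<μf)) f∉
    ... | tri≈ _ 0≡μf _ = sym 0≡μf
    ... | tri> _ _ μf<0 = contradiction (<-≤-trans μf<0 (0≤μ f)) (<-irrefl refl)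

  𝔼-initial : ∀ {φ} → Respects φ → 𝔼 μ φ ≡ v * ∑ (initials n) φ
  𝔼-initial {φ} φ-resp = begin
    𝔼 μ φ
      ≡⟨ ∑-cong F (λ f → trans (cong (_* φ f) (μ≡ f)) (trans
           (solve 3 (λ v s p → v :* s :* p := v :* (p :* s)) refl v (∑ I (λ g → indicator (g ≗? f))) (φ f))
           (cong (v *_) (sym (∑-*ˡ I (φ f) (λ g → indicator (g ≗? f))))))) ⟩
    ∑ F (λ f → v * ∑ I (λ g → φ f * indicator (g ≗? f)))
      ≡⟨ ∑-*ˡ F v (λ f → ∑ I (λ g → φ f * indicator (g ≗? f))) ⟩
    v * ∑ F (λ f → ∑ I (λ g → φ f * indicator (g ≗? f)))
      ≡⟨ cong (v *_) (∑-swap F I (λ f g → φ f * indicator (g ≗? f))) ⟩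
    v * ∑ I (λ g → ∑ F (λ f → φ f * indicator (g ≗? f)))
      ≡⟨ cong (v *_) (∑-cong I (λ g → trans
           (∑-cong F (λ f → *-comm (φ f) (indicator (g ≗? f)))) (∑-indicator g φ-resp))) ⟩
    v * ∑ I φ ∎
    where
    open ≡-Reasoning
    F = boolFuns n
    I = initials n

  v*[n+2]≡1 : v * (⟦ n ⟧ + (1ℚ + 1ℚ)) ≡ 1ℚ
  v*[n+2]≡1 = trans (trans
    (cong (v *_) (trans
      (solve 1 (λ n → n :+ con (1ℚ + 1ℚ) := con 1ℚ :+ (con 1ℚ :+ n)) refl ⟦ n ⟧)
      (cong (λ z → 1ℚ + (1ℚ + z)) (sym (trans (cong sum (map-tabulate (projection {n}) (const 1ℚ))) (sum-tabulate-1 n))))))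
    (sym (𝔼-initial {const 1ℚ} (λ _ → refl))))
    (𝔼-const isDistribution 1ℚ)

  corr₁-initial : ∀ a → corr μ (a ∷ []) ≡ v * (⟦ weight a ⟧ + ⟦ weight a ⟧ - ⟦ n ⟧)
  corr₁-initial a = trans (𝔼-initial (character-resp (a ∷ []))) (cong (v *_) (trans
    (cong (λ z → - 1ℚ * 1ℚ + (1ℚ * 1ℚ + z))
      (trans (cong sum (map-tabulate projection (character (a ∷ [])))) (sum-tabulate-χ a)))
    (solve 1 (λ z → con (- 1ℚ) :* con 1ℚ :+ (con 1ℚ :* con 1ℚ :+ z) := z) refl (⟦ weight a ⟧ + ⟦ weight a ⟧ - ⟦ n ⟧))))

  corr₁-middle : ∀ a → weight a ℕ.+ weight a ≡ n → corr μ (a ∷ []) ≡ 0ℚ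
  corr₁-middle a e = trans (corr₁-initial a) (trans
    (cong (v *_) (trans (cong (_- ⟦ n ⟧) (trans (sym (⟦⟧-homo-+ (weight a) (weight a))) (cong ⟦_⟧ e))) (+-inverseʳ ⟦ n ⟧)))
    (*-zeroʳ v))

  ⟦⟧-strict : ∀ {m n} → m ℕ.< n → 0ℚ < ⟦ n ⟧ - ⟦ m ⟧
  ⟦⟧-strict {m} m<n = 0<- (<-≤-trans (<-from 0<1 (+-comm 1ℚ ⟦ m ⟧)) (⟦⟧-mono m<n))

  corr₁-above : ∀ a → n ℕ.< weight a ℕ.+ weight a → 0ℚ < corr μ (a ∷ [])
  corr₁-above a lt = subst (0ℚ <_) (sym (corr₁-initial a))
    (0<* 0<v (subst (λ z → 0ℚ < z - ⟦ n ⟧) (⟦⟧-homo-+ (weight a) (weight a)) (⟦⟧-strict lt)))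

  corr₁-below : ∀ a → weight a ℕ.+ weight a ℕ.< n → 0ℚ < - 1ℚ * corr μ (a ∷ [])
  corr₁-below a lt = subst (0ℚ <_)
    (trans (solve 3 (λ v n w → v :* (n :- w) := con (- 1ℚ) :* (v :* (w :- n))) refl v ⟦ n ⟧ (⟦ weight a ⟧ + ⟦ weight a ⟧))
           (cong (- 1ℚ *_) (sym (corr₁-initial a))))
    (0<* 0<v (subst (λ z → 0ℚ < ⟦ n ⟧ - z) (⟦⟧-homo-+ (weight a) (weight a)) (⟦⟧-strict lt)))

  ∣corr₁∣<1 : ∀ a → ∣ corr μ (a ∷ []) ∣ < 1ℚ
  ∣corr₁∣<1 a = subst (λ c → ∣ c ∣ < 1ℚ) (sym (corr₁-initial a)) (∣∣<
    (<-from (0<* 0<v (+-mono-<-≤ (+-mono-< 0<1 0<1) (0≤+ 0≤n-w 0≤n-w)))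
      (trans (sym v*[n+2]≡1) (solve 3 (λ v n w → v :* (n :+ con (1ℚ + 1ℚ)) :=
        v :* (w :+ w :- n) :+ v :* (con (1ℚ + 1ℚ) :+ ((n :- w) :+ (n :- w)))) refl v ⟦ n ⟧ ⟦ weight a ⟧)))
    (<-from (0<* 0<v (+-mono-<-≤ (+-mono-< 0<1 0<1) (0≤+ 0≤⟦ weight a ⟧ 0≤⟦ weight a ⟧)))
      (trans (sym v*[n+2]≡1) (solve 3 (λ v n w → v :* (n :+ con (1ℚ + 1ℚ)) :=
        :- (v :* (w :+ w :- n)) :+ v :* (con (1ℚ + 1ℚ) :+ (w :+ w))) refl v ⟦ n ⟧ ⟦ weight a ⟧))))
    where
    0≤n-w : 0ℚ ≤ ⟦ n ⟧ - ⟦ weight a ⟧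
    0≤n-w = 0≤- (⟦⟧-mono (count≤n (Bool._≟ true) a))

  -- A nonnegative observable that is positive at some initial function has
  -- positive expectation.
  0<𝔼 : ∀ {φ f} → Respects φ → (∀ g → 0ℚ ≤ φ g) → f ∈ initials n → 0ℚ < φ f → 0ℚ < 𝔼 μ φ
  0<𝔼 {φ} φ-resp 0≤φ f∈ 0<φf = subst (0ℚ <_) (sym (𝔼-initial φ-resp))
    (0<* 0<v (<-≤-trans 0<φf (term≤∑ {f = φ} 0≤φ f∈)))

  ∣corr₂∣<1 : ∀ {a b} → a ≢ b → ∣ corr μ (a ∷ b ∷ []) ∣ < 1ℚ
  ∣corr₂∣<1 {a} {b} a≢b = ∣∣<
    (<-from (0<𝔼 {λ f → 1ℚ + - 1ℚ * character T f} (λ e → cong (λ z → 1ℚ + - 1ℚ * z) (character-resp T e))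
        (λ g → 0≤1+∣∣ (∣*∣≤1 { - 1ℚ} ≤-refl (∣character∣≤1 T g)))
        (there (there (∈-tabulate⁺ i))) (subst (λ z → 0ℚ < 1ℚ + - 1ℚ * z) (sym (χχ≢ aᵢ≢bᵢ)) (+-mono-< 0<1 0<1)))
      (trans (solve 1 (λ c → con 1ℚ := c :+ (con 1ℚ :+ con (- 1ℚ) :* c)) refl (corr μ T))
        (cong (corr μ T +_) (sym (𝔼-1+ (- 1ℚ))))))
    (<-from (0<𝔼 {λ f → 1ℚ + 1ℚ * character T f} (λ e → cong (λ z → 1ℚ + 1ℚ * z) (character-resp T e))
        (λ g → 0≤1+∣∣ (∣*∣≤1 {1ℚ} ≤-refl (∣character∣≤1 T g)))
        (here refl) (+-mono-< 0<1 0<1))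
      (trans (solve 1 (λ c → con 1ℚ := :- c :+ (con 1ℚ :+ con 1ℚ :* c)) refl (corr μ T))
        (cong (- corr μ T +_) (sym (𝔼-1+ 1ℚ)))))
    where
    T = a ∷ b ∷ []
    i = proj₁ (differ a≢b)
    aᵢ≢bᵢ = proj₂ (differ a≢b)
    𝔼-1+ : ∀ c → 𝔼 μ (λ f → 1ℚ + c * character T f) ≡ 1ℚ + c * corr μ T
    𝔼-1+ c = trans (𝔼-+ μ (const 1ℚ) (λ f → c * character T f))
      (cong₂ _+_ (𝔼-const isDistribution 1ℚ) (𝔼-*ˡ μ c (character T)))

-- Lists of distinct assignments

Unique-resp-↭ : ∀ {A : Set} {xs ys : List A} → xs ↭ ys → Unique xs → Unique ys
Unique-resp-↭ {A} p = Permutation.Unique-resp-↭ (setoid A) (↭⇒↭ₛ p)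

Unique-++⁻ˡ : ∀ {A : Set} (xs {ys} : List A) → Unique (xs ++ ys) → Unique xs
Unique-++⁻ˡ []       _          = []
Unique-++⁻ˡ (x ∷ xs) (x∉ ∷ xs!) = All.++⁻ˡ xs x∉ ∷ Unique-++⁻ˡ xs xs!

Unique-delete : ∀ {A : Set} (xs {ys} : List A) {x} → Unique (xs ++ x ∷ ys) → Unique (xs ++ ys)
Unique-delete xs {ys} {x} xs! with Unique-resp-↭ (shift x xs ys) xs!
... | _ ∷ rest! = rest!

∈-assignments : ∀ {n} (a : Assignment n) → a ∈ assignments n
∈-assignments []      = here refl
∈-assignments (b ∷ a) = ∈-cartesianProductWith⁺ _∷_ (∈-bits b) (∈-assignments a)
  where
  ∈-bits : ∀ b → b ∈ false ∷ true ∷ []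
  ∈-bits false = here refl
  ∈-bits true  = there (here refl)

assignments-unique : ∀ n → Unique (assignments n)
assignments-unique zero    = [] ∷ []
assignments-unique (suc n) = Unique.cartesianProductWith⁺ _∷_ ∷-injective
  (((λ ()) ∷ []) ∷ [] ∷ []) (assignments-unique n)

-- The mass of a function as an expectation

-- A product of indicators that f and g agree at a, over the assignments a in a
-- list, written as a polynomial in χ (g a) so that its expectation expands into
-- correlations.
agreement : ∀ {n} → List (Assignment n) → BoolFun n → BoolFun n → ℚ
agreement []      f g = 1ℚ
agreement (a ∷ L) f g = ½ * (1ℚ + χ (f a) * χ (g a)) * agreement L f g

½[1+χχ]≡1 : ∀ {b c} → b ≡ c → ½ * (1ℚ + χ b * χ c) ≡ 1ℚ
½[1+χχ]≡1 {true}  refl = refl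
½[1+χχ]≡1 {false} refl = refl

½[1+χχ]≡0 : ∀ {b c} → b ≢ c → ½ * (1ℚ + χ b * χ c) ≡ 0ℚ
½[1+χχ]≡0 {true}  {true}  b≢c = contradiction refl b≢c
½[1+χχ]≡0 {true}  {false} _   = refl
½[1+χχ]≡0 {false} {true}  _   = refl
½[1+χχ]≡0 {false} {false} b≢c = contradiction refl b≢c

agreement-dichotomy : ∀ {n} L (f g : BoolFun n) →
  (agreement L f g ≡ 1ℚ × All (λ a → f a ≡ g a) L) ⊎ (agreement L f g ≡ 0ℚ × ¬ f ≗ g)
agreement-dichotomy []      f g = inj₁ (refl , [])
agreement-dichotomy (a ∷ L) f g with f a Bool.≟ g a | agreement-dichotomy L f g
... | yes e | inj₁ (p , es) = inj₁ (cong₂ _*_ (½[1+χχ]≡1 e) p , e ∷ es)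
... | yes e | inj₂ (p , ne) = inj₂ (cong₂ _*_ (½[1+χχ]≡1 e) p , ne)
... | no ne | _             = inj₂ (trans (cong (_* agreement L f g) (½[1+χχ]≡0 ne)) (*-zeroˡ (agreement L f g)) , λ e → ne (e a))

agreement≡indicator : ∀ {n} (f g : BoolFun n) → agreement (assignments n) f g ≡ indicator (f ≗? g)
agreement≡indicator {n} f g with agreement-dichotomy (assignments n) f g
... | inj₁ (p , es) = trans p (sym (indicator-yes (f ≗? g) (λ a → All.lookup es (∈-assignments a))))
... | inj₂ (p , ne) = trans p (sym (indicator-no (f ≗? g) ne))

∣agreement∣≤1 : ∀ {n} L (f g : BoolFun n) → ∣ agreement L f g ∣ ≤ 1ℚ
∣agreement∣≤1 L f g with agreement-dichotomy L f g
... | inj₁ (p , _) = ≤-reflexive (cong ∣_∣ p)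
... | inj₂ (p , _) = subst (λ z → ∣ z ∣ ≤ 1ℚ) (sym p) 0≤1

-- Over all assignments, agreement is the indicator of equality with f.
mass≡𝔼 : ∀ {n} {ρ : Mass n} → IsDistribution ρ → ∀ f → 𝔼 ρ (agreement (assignments n) f) ≡ ρ f
mass≡𝔼 {n} {ρ} ρ-dist f = trans
  (∑-cong (boolFuns n) (λ g → trans (cong (ρ g *_) (agreement≡indicator f g)) (*-comm (ρ g) (indicator (f ≗? g)))))
  (∑-indicator f (IsDistribution.resp ρ-dist))

module GrowthProcess {k n} {α : Connective k} (α-mono : Monotone α) (α-bal : Balanced α) (α-proj : ¬ IsProjection α)
  (2∣n : 2 ∣ n) {μ : Mass n} (μ-uniform : IsUniformOn (λ f → IsProjection f ⊎ IsConstant f) μ) where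

  open Initial μ-uniform
  open Contraction (pivotal α-mono (balanced⇒mean≡0 {α = α} α-bal) α-proj)

  ρ : ℕ → Mass n
  ρ = growth μ α

  ρ-dist : ∀ i → IsDistribution (ρ i)
  ρ-dist = growth-isDistribution α (IsUniformOn.isDistribution μ-uniform)

  -- The correlation over T after i steps.
  c : List (Assignment n) → ℕ → ℚ
  c T i = corr (ρ i) T

  ∣c∣≤1 : ∀ T i → ∣ c T i ∣ ≤ 1ℚ
  ∣c∣≤1 T i = ∣corr∣≤1 (ρ-dist i) T

  corr-expansion : ∀ {N} → Ideal N → ∀ s S →
    (∀ t T u U → (t ∷ T) ++ (u ∷ U) ↭ s ∷ S → N (c (t ∷ T))) →
    N (λ i → c (s ∷ S) (suc i) - stab (length (s ∷ S)) k (χ ∘ α) (c (s ∷ S) i))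
  corr-expansion N-ideal s S proper = Ideal.N-cong N-ideal
    (λ i → cong (_- stab (length (s ∷ S)) k (χ ∘ α) (c (s ∷ S) i)) (sym (corr-step α (ρ i) (s ∷ S))))
    (difference (expansion refl k (χ∘-bounded α)))
    where open Expansion ρ-dist N-ideal proper

  -≡0 : ∀ {p q} → p - q ≡ 0ℚ → p ≡ q
  -≡0 {p} {q} e = trans (solve 2 (λ p q → p := (p :- q) :+ q) refl p q) (trans (cong (_+ q) e) (+-identityˡ q))

  length-split : ∀ t (T : List (Assignment n)) u U {S} → (t ∷ T) ++ (u ∷ U) ↭ S →
             suc (length T) ℕ.+ suc (length U) ≡ length S
  length-split t T u U p = trans (sym (length-++ (t ∷ T))) (↭-length p)

  -- Single assignments

  c₁-step : ∀ a i → c (a ∷ []) (suc i) ≡ stab 1 k (χ ∘ α) (c (a ∷ []) i)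
  c₁-step a i = -≡0 (corr-expansion zero-ideal a [] (λ t T u U p → contradiction
    (trans (sym (ℕ.+-suc (length T) (length U))) (ℕ.suc-injective (length-split t T u U p))) λ ()) i)

  c₁-interior : ∀ a i → ∣ c (a ∷ []) i ∣ < 1ℚ
  c₁-interior a zero    = ∣corr₁∣<1 a
  c₁-interior a (suc i) = subst (λ z → ∣ z ∣ < 1ℚ) (sym (c₁-step a i)) (stab₁-interior (c₁-interior a i))

  c₁-middle : ∀ a → c (a ∷ []) 0 ≡ 0ℚ → ∀ i → c (a ∷ []) i ≡ 0ℚ
  c₁-middle a e zero    = e
  c₁-middle a e (suc i) = trans (c₁-step a i) (trans (cong (stab 1 k (χ ∘ α)) (c₁-middle a e i))
    (trans (stab₁≡ext k (χ ∘ α) 0ℚ) (balanced⇒mean≡0 {α = α} α-bal)))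

  -- A bias towards the sign ε grows to its extreme: 1 - x decays geometrically.
  module Biased (a : Assignment n) {ε : ℚ} (ε² : ε * ε ≡ 1ℚ) (∣ε∣ : ∣ ε ∣ ≡ 1ℚ) (0<x₀ : 0ℚ < ε * c (a ∷ []) 0) where

    x : ℕ → ℚ
    x i = ε * c (a ∷ []) i

    ∣x∣<1 : ∀ i → ∣ x i ∣ < 1ℚ
    ∣x∣<1 i = subst (_< 1ℚ) (sym (trans (∣p*q∣≡∣p∣*∣q∣ ε (c (a ∷ []) i)) (trans (cong (_* ∣ c (a ∷ []) i ∣) ∣ε∣) (*-identityˡ ∣ c (a ∷ []) i ∣))))
      (c₁-interior a i)

    amplify : ∀ i → 0ℚ < x i → δ * (x i * (1ℚ - x i * x i)) ≤ x (suc i) - x i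
    amplify i 0<x = *-cancelˡ-≤-pos (x i) {{positive 0<x}} (subst₂ _≤_
      (trans (cong (λ z → δ * (z * (1ℚ - z))) y²≡)
        (solve 2 (λ d x → d :* (x :* x :* (con 1ℚ :- x :* x)) := x :* (d :* (x :* (con 1ℚ :- x :* x)))) refl δ (x i)))
      (trans (cong (y *_) (cong (_- y) (sym (c₁-step a i)))) (trans (solve 3 (λ e y z → y :* (z :- y) := y :* z :- y :* y) refl ε y z)
        (trans (cong₂ (λ p q → p - q) yz≡ y²≡) (solve 2 (λ x w → x :* w :- x :* x := x :* (w :- x)) refl (x i) (x (suc i))))))
      (drift (c₁-interior a i)))
      where
      y = c (a ∷ []) i
      z = c (a ∷ []) (suc i)
      yz≡ : y * z ≡ x i * x (suc i)
      yz≡ = trans (sym (trans (cong (_* (y * z)) ε²) (*-identityˡ (y * z))))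
        (solve 3 (λ e y z → e :* e :* (y :* z) := e :* y :* (e :* z)) refl ε y z)
      y²≡ : y * y ≡ x i * x i
      y²≡ = trans (sym (trans (cong (_* (y * y)) ε²) (*-identityˡ (y * y))))
        (solve 2 (λ e y → e :* e :* (y :* y) := e :* y :* (e :* y)) refl ε y)

    increasing : ∀ i → x 0 ≤ x i
    increasing zero    = ≤-refl
    increasing (suc i) = ≤-trans (increasing i) (≤-from
      (≤-trans (0≤* (<⇒≤ 0<δ) (0≤* (<⇒≤ 0<xᵢ) (<⇒≤ (0<1-y² (∣x∣<1 i))))) (amplify i 0<xᵢ))
      (solve 2 (λ x w → w := x :+ (w :- x)) refl (x i) (x (suc i))))
      where 0<xᵢ = <-≤-trans 0<x₀ (increasing i)

    limit : Converges (λ i → 1ℚ - x i) 0ℚ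
    limit = contracting {δ = δ * x 0} (0<* 0<δ 0<x₀) δx≤1 (λ i → 0≤1-∣∣ (<⇒≤ (∣x∣<1 i))) (⟶-const 0ℚ)
      (λ i → let 0<xᵢ = <-≤-trans 0<x₀ (increasing i) in ≤-from
        (0≤+ (0≤- (amplify i 0<xᵢ))
             (0≤* (0≤* (0≤1-∣∣ (<⇒≤ (∣x∣<1 i))) (<⇒≤ 0<δ)) (0≤+ (0≤- (increasing i)) (0≤p² (x i)))))
        (solve 4 (λ d x₀ x w → (con 1ℚ :- d :* x₀) :* (con 1ℚ :- x) :+ con 0ℚ :=
            (con 1ℚ :- w) :+ (((w :- x) :- d :* (x :* (con 1ℚ :- x :* x))) :+
              (con 1ℚ :- x) :* d :* ((x :- x₀) :+ x :* x)))
          refl δ (x 0) (x i) (x (suc i))))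
      where
      δx≤1 : δ * x 0 ≤ 1ℚ
      δx≤1 = ≤-from (0≤+ (0≤- δ≤1) (0≤* (<⇒≤ 0<δ) (0≤1-∣∣ (<⇒≤ (∣x∣<1 0)))))
        (solve 2 (λ d x → con 1ℚ := d :* x :+ ((con 1ℚ :- d) :+ d :* (con 1ℚ :- x))) refl δ (x 0))

  -- The middle layer

  Middle : Assignment n → Set
  Middle a = weight a ≡ n / 2

  halves : (n / 2) ℕ.+ (n / 2) ≡ n
  halves = trans (cong ((n / 2) ℕ.+_) (sym (ℕ.+-identityʳ (n / 2)))) (trans (ℕ.*-comm 2 (n / 2)) (m/n*n≡m 2∣n))

  c₁-Middle : ∀ {a} → Middle a → ∀ i → c (a ∷ []) i ≡ 0ℚ
  c₁-Middle {a} mid = c₁-middle a (corr₁-middle a (trans (cong₂ ℕ._+_ mid mid) halves))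

  -- Exact, because the correlations over single middle assignments vanish.
  c₂-step : ∀ {a b} → Middle a → Middle b → ∀ i →
            c (a ∷ b ∷ []) (suc i) ≡ stab 2 k (χ ∘ α) (c (a ∷ b ∷ []) i)
  c₂-step {a} {b} a-mid b-mid i = -≡0 (corr-expansion zero-ideal a (b ∷ []) proper i)
    where
    proper : ∀ t T u U → (t ∷ T) ++ (u ∷ U) ↭ a ∷ b ∷ [] → ∀ i → c (t ∷ T) i ≡ 0ℚ
    proper t [] u U p = c₁-Middle (All.head (All-resp-↭ (↭-sym p) (a-mid ∷ b-mid ∷ [])))
    proper t (t′ ∷ T) u U p = contradiction
      (trans (sym (ℕ.+-suc (length T) (length U))) (ℕ.suc-injective (ℕ.suc-injective (length-split t (t′ ∷ T) u U p)))) λ ()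

  c₂-null : ∀ {a b} → Middle a → Middle b → a ≢ b → Converges (c (a ∷ b ∷ [])) 0ℚ
  c₂-null {a} {b} a-mid b-mid a≢b = ⟶0-∣∣⁻ (contracting {δ = δ * (1ℚ - z 0)}
    (0<* 0<δ 0<1-z) δ′≤1 (λ i → 0≤∣p∣ (c₂ i)) (⟶-const 0ℚ)
    (λ i → ≤-trans (step≤ i) (≤-from
      (0≤* (0≤* (<⇒≤ 0<δ) (0≤∣p∣ (c₂ i))) (0≤- (decreasing i)))
      (solve 3 (λ d z₀ z → (con 1ℚ :- d :* (con 1ℚ :- z₀)) :* z :+ con 0ℚ :=
          z :* (con 1ℚ :- d :* (con 1ℚ :- z)) :+ d :* z :* (z₀ :- z)) refl δ (z 0) (z i)))))
    where
    c₂ = c (a ∷ b ∷ [])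
    z : ℕ → ℚ
    z i = ∣ c₂ i ∣
    0<1-z : 0ℚ < 1ℚ - z 0
    0<1-z = 0<- (∣corr₂∣<1 a≢b)
    δ′≤1 : δ * (1ℚ - z 0) ≤ 1ℚ
    δ′≤1 = ≤-from (0≤+ (0≤- δ≤1) (0≤* (<⇒≤ 0<δ) (0≤∣p∣ (c₂ 0))))
      (solve 2 (λ d z → con 1ℚ := d :* (con 1ℚ :- z) :+ ((con 1ℚ :- d) :+ d :* z)) refl δ (z 0))
    step≤ : ∀ i → z (suc i) ≤ z i * (1ℚ - δ * (1ℚ - z i))
    step≤ i = subst (λ y → ∣ y ∣ ≤ z i * (1ℚ - δ * (1ℚ - z i))) (sym (c₂-step a-mid b-mid i))
      (contract₂ (∣c∣≤1 (a ∷ b ∷ []) i))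
    decreasing : ∀ i → z i ≤ z 0
    decreasing zero    = ≤-refl
    decreasing (suc i) = ≤-trans (≤-trans (step≤ i) (≤-from
      (0≤* (0≤* (0≤∣p∣ (c₂ i)) (<⇒≤ 0<δ)) (0≤- (∣c∣≤1 (a ∷ b ∷ []) i)))
      (solve 2 (λ d z → z := z :* (con 1ℚ :- d :* (con 1ℚ :- z)) :+ z :* d :* (con 1ℚ :- z)) refl δ (z i))))
      (decreasing i)

  -- Induction on the number of assignments, bounded by ℓ.
  middle-null : ∀ ℓ {s S} → length S ℕ.≤ ℓ → All Middle (s ∷ S) → Unique (s ∷ S) → Converges (c (s ∷ S)) 0ℚ
  middle-null _ {s} {[]} _ (mid ∷ []) _ = ⟶-cong (λ i → sym (c₁-Middle mid i)) (⟶-const 0ℚ)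
  middle-null _ {s} {b ∷ []} _ (s-mid ∷ b-mid ∷ []) ((s≢b ∷ []) ∷ _) = c₂-null s-mid b-mid s≢b
  middle-null (suc ℓ) {s} {b ∷ d ∷ S} (ℕ.s≤s S≤ℓ) mids uniq = ⟶0-∣∣⁻
    (contracting 0<mδ mδ≤1 (λ i → 0≤∣p∣ (c₃ i)) (⟶0-∣∣ error)
      (λ i → ≤-trans
        (subst (λ z → ∣ z ∣ ≤ ∣ F (c₃ i) ∣ + ∣ c₃ (suc i) - F (c₃ i) ∣)
          (solve 2 (λ x y → y :+ (x :- y) := x) refl (c₃ (suc i)) (F (c₃ i)))
          (∣p+q∣≤∣p∣+∣q∣ (F (c₃ i)) (c₃ (suc i) - F (c₃ i))))
        (+-monoˡ-≤ ∣ c₃ (suc i) - F (c₃ i) ∣ (contract₃ (length S) (∣c∣≤1 (s ∷ b ∷ d ∷ S) i)))))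
    where
    c₃ = c (s ∷ b ∷ d ∷ S)
    F = stab (3 ℕ.+ length S) k (χ ∘ α)
    error : Converges (λ i → c₃ (suc i) - F (c₃ i)) 0ℚ
    error = corr-expansion null-ideal s (b ∷ d ∷ S) (λ t T u U p → middle-null ℓ
      (ℕ.≤-trans (ℕ.≤-trans (ℕ.m≤m+n (length T) (length U))
        (ℕ.≤-reflexive (ℕ.suc-injective (trans (sym (ℕ.+-suc (length T) (length U))) (ℕ.suc-injective (length-split t T u U p))))))
        S≤ℓ)
      (All.++⁻ˡ (t ∷ T) (All-resp-↭ (↭-sym p) mids))
      (Unique-++⁻ˡ (t ∷ T) (Unique-resp-↭ (↭-sym p) uniq)))

  -- The limiting distribution

  -- The limit of the expectation of χ at a single assignment.
  tri-bias : ∀ {A B C : Set} → Tri A B C → ℚ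
  tri-bias (tri< _ _ _) = - 1ℚ
  tri-bias (tri≈ _ _ _) = 0ℚ
  tri-bias (tri> _ _ _) = 1ℚ

  bias : Assignment n → ℚ
  bias a = tri-bias (ℕ.<-cmp (weight a) (n / 2))

  -- The position of a relative to the middle layer, with its bias.
  data Layer (a : Assignment n) : Set where
    below  : weight a ℕ.< n / 2 → bias a ≡ - 1ℚ → Layer a
    middle : weight a ≡ n / 2 → bias a ≡ 0ℚ → Layer a
    above  : n / 2 ℕ.< weight a → bias a ≡ 1ℚ → Layer a

  layer : ∀ a → Layer a
  layer a = classify (ℕ.<-cmp (weight a) (n / 2)) refl
    where
    classify : ∀ t → ℕ.<-cmp (weight a) (n / 2) ≡ t → Layer a
    classify (tri< w< _ _) e = below w< (cong tri-bias e)
    classify (tri≈ _ w≡ _) e = middle w≡ (cong tri-bias e)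
    classify (tri> _ _ <w) e = above <w (cong tri-bias e)

  -- The limiting probability of the value f a at a.
  factor : BoolFun n → Assignment n → ℚ
  factor f a = ½ * (1ℚ + χ (f a) * bias a)

  -- The mass of f when the values at distinct assignments are independent.
  limitMass : List (Assignment n) → Mass n
  limitMass []      f = 1ℚ
  limitMass (a ∷ L) f = factor f a * limitMass L f

  biases : List (Assignment n) → ℚ
  biases []      = 1ℚ
  biases (a ∷ T) = bias a * biases T

  ∣factor∣≤1 : ∀ f a → ∣ factor f a ∣ ≤ 1ℚ
  ∣factor∣≤1 f a = go (f a) (layer a)
    where
    go : ∀ b → Layer a → ∣ ½ * (1ℚ + χ b * bias a) ∣ ≤ 1ℚ
    go true  (below  _ e) rewrite e = 0≤1
    go false (below  _ e) rewrite e = ≤-refl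
    go true  (middle _ e) rewrite e = <⇒≤ (<-from {½} 0<½ refl)
    go false (middle _ e) rewrite e = <⇒≤ (<-from {½} 0<½ refl)
    go true  (above  _ e) rewrite e = ≤-refl
    go false (above  _ e) rewrite e = 0≤1

  0≤factor : ∀ f a → 0ℚ ≤ factor f a
  0≤factor f a = go (f a) (layer a)
    where
    go : ∀ b → Layer a → 0ℚ ≤ ½ * (1ℚ + χ b * bias a)
    go true  (below  _ e) rewrite e = ≤-refl
    go false (below  _ e) rewrite e = 0≤1
    go true  (middle _ e) rewrite e = 0≤½
    go false (middle _ e) rewrite e = 0≤½
    go true  (above  _ e) rewrite e = 0≤1
    go false (above  _ e) rewrite e = ≤-refl

  -- Interpolates between correlations (L empty) and masses (T empty).
  moment : List (Assignment n) → List (Assignment n) → BoolFun n → ℕ → ℚ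
  moment T L f i = 𝔼 (ρ i) (λ g → character T g * agreement L f g)

  moment-middle : ∀ T a L f i →
    moment T (a ∷ L) f i ≡ ½ * moment T L f i + ½ * χ (f a) * moment (a ∷ T) L f i
  moment-middle T a L f i = trans
    (𝔼-cong (ρ i) (λ g → solve 4 (λ t x y A →
        t :* (con ½ :* (con 1ℚ :+ x :* y) :* A) := con ½ :* (t :* A) :+ con ½ :* x :* (y :* t :* A))
      refl (character T g) (χ (f a)) (χ (g a)) (agreement L f g)))
    (trans (𝔼-+ (ρ i) (λ g → ½ * (character T g * agreement L f g))
                      (λ g → ½ * χ (f a) * (character (a ∷ T) g * agreement L f g)))
      (cong₂ _+_ (𝔼-*ˡ (ρ i) ½ (λ g → character T g * agreement L f g))
                 (𝔼-*ˡ (ρ i) (½ * χ (f a)) (λ g → character (a ∷ T) g * agreement L f g))))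

  -- At an assignment where the value is asymptotically determined, χ (g a) may
  -- be replaced by its limit ε: the cost is at most 𝔼 (1 - ε χ (g a)).
  moment-biased : ∀ T a L f i {ε} → (∀ b → ∣ ½ * (χ b - ε) ∣ ≤ 1ℚ - ε * χ b) →
    ∣ moment T (a ∷ L) f i - ½ * (1ℚ + χ (f a) * ε) * moment T L f i ∣ ≤ ∣ 1ℚ - ε * c (a ∷ []) i ∣
  moment-biased T a L f i {ε} bound = subst (λ z → ∣ z ∣ ≤ ∣ 1ℚ - ε * c (a ∷ []) i ∣) split
    (≤-trans (𝔼-abs≤ (ρ-dist i) small) (≤-trans (≤-reflexive 𝔼-bound) (p≤∣p∣ (1ℚ - ε * c (a ∷ []) i))))
    where
    w : BoolFun n → ℚ
    w g = χ (f a) * (character T g * agreement L f g)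
    small : ∀ g → ∣ ½ * (χ (g a) - ε) * w g ∣ ≤ 1ℚ + - ε * character (a ∷ []) g
    small g = ≤-trans (∣*∣≤∣∣ (½ * (χ (g a) - ε))
        (∣*∣≤1 {χ (f a)} (≤-reflexive (∣χ∣ (f a))) (∣*∣≤1 {character T g} (∣character∣≤1 T g) (∣agreement∣≤1 L f g))))
      (subst (∣ ½ * (χ (g a) - ε) ∣ ≤_)
        (solve 2 (λ e x → con 1ℚ :- e :* x := con 1ℚ :+ (:- e) :* (x :* con 1ℚ)) refl ε (χ (g a)))
        (bound (g a)))
    𝔼-bound : 𝔼 (ρ i) (λ g → 1ℚ + - ε * character (a ∷ []) g) ≡ 1ℚ - ε * c (a ∷ []) i
    𝔼-bound = trans (𝔼-+ (ρ i) (const 1ℚ) (λ g → - ε * character (a ∷ []) g))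
      (trans (cong₂ _+_ (𝔼-const (ρ-dist i) 1ℚ) (𝔼-*ˡ (ρ i) (- ε) (character (a ∷ []))))
        (solve 2 (λ e x → con 1ℚ :+ (:- e) :* x := con 1ℚ :- e :* x) refl ε (c (a ∷ []) i)))
    q = ½ * (1ℚ + χ (f a) * ε)
    split : 𝔼 (ρ i) (λ g → ½ * (χ (g a) - ε) * w g) ≡ moment T (a ∷ L) f i - q * moment T L f i
    split = trans
      (𝔼-cong (ρ i) (λ g → solve 5 (λ t x y e A →
          con ½ :* (y :- e) :* (x :* (t :* A)) :=
          t :* (con ½ :* (con 1ℚ :+ x :* y) :* A) :+ (:- (con ½ :* (con 1ℚ :+ x :* e))) :* (t :* A))
        refl (character T g) (χ (f a)) (χ (g a)) ε (agreement L f g)))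
      (trans (𝔼-+ (ρ i) (λ g → character T g * agreement (a ∷ L) f g) (λ g → - q * (character T g * agreement L f g)))
        (trans (cong (moment T (a ∷ L) f i +_) (𝔼-*ˡ (ρ i) (- q) (λ g → character T g * agreement L f g)))
          (solve 3 (λ p q m → p :+ (:- q) :* m := p :- q :* m) refl (moment T (a ∷ L) f i) q (moment T L f i))))

  moment-limit-biased : ∀ T a L f {ε} → (∀ b → ∣ ½ * (χ b - ε) ∣ ≤ 1ℚ - ε * χ b) →
    Converges (λ i → 1ℚ - ε * c (a ∷ []) i) 0ℚ → bias a ≡ ε →
    Converges (moment T L f) (biases T * limitMass L f) →
    Converges (moment T (a ∷ L) f) (biases T * limitMass (a ∷ L) f)
  moment-limit-biased T a L f bound to1 refl rec = subst (Converges (moment T (a ∷ L) f))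
    (solve 3 (λ q t l → q :* (t :* l) := t :* (q :* l)) refl (factor f a) (biases T) (limitMass L f))
    (⟶-near (⟶0-dominated (λ i → moment-biased T a L f i bound) to1) (⟶-*ˡ (∣factor∣≤1 f a) rec))

  -- Middle assignments move from L to T, where they contribute vanishing
  -- correlations; all others are replaced by their limiting values.
  moment-limit : ∀ L T f → All Middle T → Unique (T ++ L) →
                 Converges (moment T L f) (biases T * limitMass L f)
  moment-limit [] [] f _ _ = ⟶-cong (λ i → sym (𝔼-const (ρ-dist i) 1ℚ)) (⟶-const 1ℚ)
  moment-limit [] (t ∷ T) f mids uniq = subst (Converges (moment (t ∷ T) [] f)) (sym limit≡0)
    (⟶-cong (λ i → 𝔼-cong (ρ i) (λ g → sym (*-identityʳ (character (t ∷ T) g))))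
      (middle-null (length T) ℕ.≤-refl mids (Unique-++⁻ˡ (t ∷ T) uniq)))
    where
    limit≡0 : biases (t ∷ T) * 1ℚ ≡ 0ℚ
    limit≡0 with layer t
    ... | below w< _ = contradiction (All.head mids) (ℕ.<⇒≢ w<)
    ... | middle _ e = trans (cong (λ z → z * biases T * 1ℚ) e)
      (solve 1 (λ b → con 0ℚ :* b :* con 1ℚ := con 0ℚ) refl (biases T))
    ... | above <w _ = contradiction (sym (All.head mids)) (ℕ.<⇒≢ <w)
  moment-limit (a ∷ L) T f mids uniq with layer a
  ... | below w< e = moment-limit-biased T a L f
    (λ { true → ≤-from {∣ ½ * (χ true - - 1ℚ) ∣} 0≤1 refl ; false → ≤-refl })
    (Biased.limit a refl refl (corr₁-below a (subst (weight a ℕ.+ weight a ℕ.<_) halves (ℕ.+-mono-< w< w<))))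
    e (moment-limit L T f mids (Unique-delete T uniq))
  ... | above <w e = moment-limit-biased T a L f
    (λ { true → ≤-refl ; false → ≤-from {∣ ½ * (χ false - 1ℚ) ∣} 0≤1 refl })
    (Biased.limit a refl refl (subst (0ℚ <_) (sym (*-identityˡ (corr μ (a ∷ []))))
      (corr₁-above a (subst (ℕ._< weight a ℕ.+ weight a) halves (ℕ.+-mono-< <w <w)))))
    e (moment-limit L T f mids (Unique-delete T uniq))
  ... | middle mid _ = subst (Converges (moment T (a ∷ L) f))
    (solve 4 (λ x b t l → con ½ :* (t :* l) :+ con ½ :* x :* (b :* t :* l) :=
                          t :* (con ½ :* (con 1ℚ :+ x :* b) :* l)) refl (χ (f a)) (bias a) (biases T) (limitMass L f))
    (⟶-cong (λ i → sym (moment-middle T a L f i))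
      (⟶-+ (⟶-*ˡ ½≤1 (moment-limit L T f mids (Unique-delete T uniq)))
           (⟶-*ˡ (∣*∣≤1 {½} ½≤1 (≤-reflexive (∣χ∣ (f a)))) (moment-limit L (a ∷ T) f (mid ∷ mids) uniq′))))
    where
    ½≤1 : ∣ ½ ∣ ≤ 1ℚ
    ½≤1 = <⇒≤ (<-from {½} 0<½ refl)
    uniq′ : Unique (a ∷ T ++ L)
    uniq′ = Unique-resp-↭ (shift a T L) uniq

  π : Mass n
  π = limitMass (assignments n)

  π-limit : ∀ f → Converges (λ i → ρ i f) (π f)
  π-limit f = subst (Converges (λ i → ρ i f)) (*-identityˡ (π f))
    (⟶-cong (λ i → trans (𝔼-cong (ρ i) (λ g → *-identityˡ (agreement (assignments n) f g))) (mass≡𝔼 (ρ-dist i) f))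
      (moment-limit (assignments n) [] f [] (assignments-unique n)))

  limitMass-cong : ∀ L {f g} → (∀ a → factor f a ≡ factor g a) → limitMass L f ≡ limitMass L g
  limitMass-cong []      e = refl
  limitMass-cong (a ∷ L) e = cong₂ _*_ (e a) (limitMass-cong L e)

  limitMass-0≤ : ∀ L f → 0ℚ ≤ limitMass L f
  limitMass-0≤ []      f = 0≤1
  limitMass-0≤ (a ∷ L) f = 0≤* (0≤factor f a) (limitMass-0≤ L f)

  limitMass-0< : ∀ L {f} → (∀ a → 0ℚ < factor f a) → 0ℚ < limitMass L f
  limitMass-0< []      0<f = 0<1
  limitMass-0< (a ∷ L) 0<f = 0<* (0<f a) (limitMass-0< L 0<f)

  limitMass-≡0 : ∀ {L f a} → a ∈ L → factor f a ≡ 0ℚ → limitMass L f ≡ 0ℚ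
  limitMass-≡0 {_ ∷ L} {f} (here refl) e = trans (cong (_* limitMass L f) e) (*-zeroˡ (limitMass L f))
  limitMass-≡0 {b ∷ L} {f} (there a∈)  e = trans (cong (factor f b *_) (limitMass-≡0 a∈ e)) (*-zeroʳ (factor f b))

  -- The factor of a slice function at a, which depends on a only.
  sliceFactor : ∀ a → Layer a → ℚ
  sliceFactor a (below  _ _) = 1ℚ
  sliceFactor a (middle _ _) = ½
  sliceFactor a (above  _ _) = 1ℚ

  0<sliceFactor : ∀ a (l : Layer a) → 0ℚ < sliceFactor a l
  0<sliceFactor a (below  _ _) = 0<1
  0<sliceFactor a (middle _ _) = 0<½
  0<sliceFactor a (above  _ _) = 0<1

  slice-factor : ∀ {f} → Slice (n / 2) f → ∀ a → factor f a ≡ sliceFactor a (layer a)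
  slice-factor {f} sl a with layer a
  ... | below  w< e = cong₂ (λ b s → ½ * (1ℚ + χ b * s)) (proj₂ (sl a) w<) e
  ... | middle _  e = trans (cong (λ s → ½ * (1ℚ + χ (f a) * s)) e)
    (solve 1 (λ x → con ½ :* (con 1ℚ :+ x :* con 0ℚ) := con ½) refl (χ (f a)))
  ... | above  <w e = cong₂ (λ b s → ½ * (1ℚ + χ b * s)) (proj₁ (sl a) <w) e

  support⇒slice : ∀ f → 0ℚ < π f → Slice (n / 2) f
  support⇒slice f 0<π a = above⇒true , below⇒false
    where
    not-0 : factor f a ≢ 0ℚ
    not-0 e = <-irrefl (sym (limitMass-≡0 (∈-assignments a) e)) 0<π
    above⇒true : n / 2 ℕ.< weight a → f a ≡ true
    above⇒true <w with layer a | f a in eq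
    ... | _            | true  = refl
    ... | below  w< _  | false = contradiction w< (ℕ.<-asym <w)
    ... | middle w≡ _  | false = contradiction (sym w≡) (ℕ.<⇒≢ <w)
    ... | above  _  e  | false = contradiction (cong₂ (λ b s → ½ * (1ℚ + χ b * s)) eq e) not-0
    below⇒false : weight a ℕ.< n / 2 → f a ≡ false
    below⇒false w< with layer a | f a in eq
    ... | _            | false = refl
    ... | above  <w _  | true  = contradiction <w (ℕ.<-asym w<)
    ... | middle w≡ _  | true  = contradiction w≡ (ℕ.<⇒≢ w<)
    ... | below  _  e  | true  = contradiction (cong₂ (λ b s → ½ * (1ℚ + χ b * s)) eq e) not-0

  π-uniform : IsUniformOn (Slice (n / 2)) π
  π-uniform = record
    { isDistribution = record
      { resp        = λ f≗g → limitMass-cong (assignments n) (λ a → cong (λ b → ½ * (1ℚ + χ b * bias a)) (f≗g a))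
      ; nonNegative = limitMass-0≤ (assignments n)
      -- Total mass is preserved in the limit of a finite sum.
      ; total       = sym (⟶-const-unique
          (⟶-cong (λ i → IsDistribution.total (ρ-dist i)) (⟶-∑ (boolFuns n) π-limit)))
      }
    ; support = λ f → mk⇔ (support⇒slice f) (λ sl → limitMass-0< (assignments n)
        (λ a → subst (0ℚ <_) (sym (slice-factor sl a)) (0<sliceFactor a (layer a))))
    ; uniform = λ sf sg → limitMass-cong (assignments n)
        (λ a → trans (slice-factor sf a) (sym (slice-factor sg a)))
    }

theorem5p16 : ∀ {k n : ℕ} (α : Connective k) →
    Monotone α → Balanced α → ¬ IsProjection α →
    2 ∣ n →
    (μ : Mass n) → IsUniformOn (λ f → IsProjection f ⊎ IsConstant f) μ →
    ∃ λ (π : Mass n) →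
    IsLimitingDistribution μ α π × IsUniformOn (Slice (n / 2)) π
theorem5p16 α α-mono α-bal α-proj 2∣n μ μ-uniform = π , (λ f → π-limit f .within) , π-uniform
  where open GrowthProcess α-mono α-bal α-proj 2∣n μ-uniform
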